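{- Let $a\ge 1$ and $k\ge 3$ be integers. Then there is $n_0=n_0(a,k)$ such that for every $n\ge n_0$ with $k\mid n$ the $(a:a)$ Maker-Breaker $S_k$-factor game $\mathcal{S}_{k,n}$ on $E(K_n)$ satisfies $$\tau_{\mathcal{S}_{k,n}}(a:a)\le\begin{cases}\left\lceil \frac{(k-1)n}{ka}\right\rceil, & \text{if } a\nmid \frac{(k-1)n}{k},\\ \frac{(k-1)n}{ka}+1, & \text{otherwise.}\end{cases}$$
   Context: In the $(a:a)$ Maker-Breaker game with board $X=E(K_n)$ (the edge set of the complete graph on $n$ vertices) and family of winning sets $\mathcal{F}\subseteq 2^X$, Breaker and Maker alternately claim $a$ previously unclaimed elements of $X$ per move (fewer if fewer remain), and Breaker moves first. Maker wins at the moment she has claimed all elements of some $F\in\mathcal{F}$ (this may happen before she has used all $a$ steps of her move); if she has not done so by the time all of $X$ is claimed, Breaker wins. $\tau_{\mathcal{F}}(a:a)$ denotes the least number of moves $t$ such that Maker has a strategy to win the $(a:a)$ game $\mathcal{F}$ within $t$ of her moves, against any strategy of Breaker ($\tau_{\mathcal F}(a:a)=\infty$ if Breaker has a winning strategy). $S_k$ denotes the star with $k-1$ leaves (so $k$ vertices). For $k\mid n$, in the $S_k$-factor game $\mathcal{S}_{k,n}$ the winning sets are the edge sets of all $S_k$-factors of $K_n$, i.e. of all collections of $n/k$ pairwise vertex-disjoint copies of $S_k$ in $K_n$ (covering all $n$ vertices). -}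

module Defs where

open import Data.Fin using (Fin; _<?_)
open import Data.Fin.Subset using (Subset; _∈_; _∉_; _⊆_; _∪_; _∩_; ∁; ⋃; ⁅_⁆; ∣_∣; Empty)
open import Data.List using (List; []; _∷_; map; filter; length; lookup; allFin; cartesianProduct)
open import Data.Nat using (ℕ; zero; suc; _+_; _*_; _∸_; _⊓_; _≤_; _/_; NonZero)
open import Data.Product using (Σ-syntax; ∃-syntax; _×_; _,_; proj₁; proj₂)
open import Data.Sum using (_⊎_)
open import Function.Bundles using (_⇔_)
open import Relation.Binary.PropositionalEquality using (_≡_; _≢_)

⌈_/_⌉ : (x y : ℕ) .{{_ : NonZero y}} → ℕ
⌈ x / y ⌉ = (x + (y ∸ 1)) / y

-- The (a : a) Maker-Breaker game on the board Fin m with winning sets 𝓕.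
module MakerBreaker {m : ℕ} (a : ℕ) (𝓕 : Subset m → Set) where

  -- Breaker's move followed by Maker's reply.
  Round : Set
  Round = Subset m × Subset m

  -- Most recent round first.
  History : Set
  History = List Round

  breakerClaims makerClaims claimed : History → Subset m
  breakerClaims h = ⋃ (map proj₁ h)
  makerClaims   h = ⋃ (map proj₂ h)
  claimed       h = breakerClaims h ∪ makerClaims h

  -- A move s is legal, when the elements of c are already claimed, if it
  -- consists of exactly a unclaimed elements, or of all unclaimed elements if
  -- there are fewer than a.  On a full board the only legal move is empty.
  Legal : Subset m → Subset m → Set
  Legal c s = s ⊆ ∁ c × ∣ s ∣ ≡ a ⊓ ∣ ∁ c ∣

  BreakerStrategy : Set
  BreakerStrategy = (h : History) → Σ[ b ∈ Subset m ] Legal (claimed h) b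

  MakerStrategy : Set
  MakerStrategy = (h : History) (b : Subset m) → Σ[ s ∈ Subset m ] Legal (claimed h ∪ b) s

  play : MakerStrategy → BreakerStrategy → ℕ → History
  play μ β zero    = []
  play μ β (suc t) = (b , proj₁ (μ h b)) ∷ h
    where
    h : History
    h = play μ β t
    b : Subset m
    b = proj₁ (β h)

  -- Maker's claims only grow, so she completes a winning set at some point
  -- during a move exactly when she owns it after the whole move, however she
  -- spends its remaining steps.
  MakerHasWon : History → Set
  MakerHasWon h = ∃[ F ] 𝓕 F × F ⊆ makerClaims h

  MakerWinsWithin : ℕ → Set
  MakerWinsWithin t =
    Σ[ μ ∈ MakerStrategy ] ∀ (β : BreakerStrategy) → ∃[ s ] s ≤ t × MakerHasWon (play μ β s)

  -- IsTau t states τ_𝓕(a : a) = t for finite t; τ_𝓕(a : a) = ∞ when no t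
  -- satisfies it.
  IsTau : ℕ → Set
  IsTau t = MakerWinsWithin t × (∀ s → MakerWinsWithin s → t ≤ s)

-- The edges {u , v} of Kₙ, each listed once, as the pair with u < v.
edges : (n : ℕ) → List (Fin n × Fin n)
edges n = filter (λ (u , v) → u <? v) (cartesianProduct (allFin n) (allFin n))

-- Edges are referred to by their position in this list.
Board : ℕ → ℕ
Board n = length (edges n)

-- A copy of S_k (a star with k vertices) in Kₙ.
record Star (k n : ℕ) : Set where
  field
    centre   : Fin n
    leaves   : Subset n
    centre∉  : centre ∉ leaves
    size     : suc ∣ leaves ∣ ≡ k

  vertices : Subset n
  vertices = ⁅ centre ⁆ ∪ leaves

  HasEdge : Fin (Board n) → Set
  HasEdge e with lookup (edges n) e
  ... | u , v = (u ≡ centre × v ∈ leaves) ⊎ (v ≡ centre × u ∈ leaves)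

record StarFactor (k n : ℕ) .{{_ : NonZero k}} : Set where
  field
    star     : Fin (n / k) → Star k n
    disjoint : ∀ {i j} → i ≢ j → Empty (Star.vertices (star i) ∩ Star.vertices (star j))
    covering : ∀ v → ∃[ i ] v ∈ Star.vertices (star i)

  HasEdge : Fin (Board n) → Set
  HasEdge e = ∃[ i ] Star.HasEdge (star i) e

-- The winning sets: edge sets of S_k-factors of Kₙ.
𝓢 : (k n : ℕ) .{{_ : NonZero k}} → Subset (Board n) → Set
𝓢 k n F = Σ[ P ∈ StarFactor k n ] ∀ e → e ∈ F ⇔ StarFactor.HasEdge P e

{-# OPTIONS --safe #-}

-- Fix n / k vertices as centres and let Maker claim leaf–centre edges only.
-- After each of her moves Breaker owns no edge between an untouched leaf and
-- an open centre: a Breaker move adds at most a such edges, and each of her a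
-- steps disposes of one of them by attaching its leaf elsewhere.  Filling up
-- the last few centres that lack several leaves may let a bounded number of
-- these edges through; afterwards every open centre lacks exactly one leaf,
-- so that a step can dispose of two edges, and the backlog vanishes.  Thus no
-- edge is wasted until m ≤ a leaves are left.  By averaging there is a
-- bijection from them to the m open centres with at most a / m pairs blocked
-- by Breaker.  A blocked pair (v , c) costs one extra edge: v is attached to
-- a reserved complete star c′, one of whose leaves w moves to c.  For m < a
-- this fits into a single move.  For m ≡ a at most one pair is blocked; Maker
-- claims v c′ and completes the exchange in her next move, for which a ≡ 1
-- leaves her two candidates w (this needs k ≥ 3).
module Submission where

open import Defs
open import Data.Bool using (Bool; true; false; _∨_)
open import Data.Fin using (Fin; zero; suc; toℕ; _↑ˡ_; _↑ʳ_; splitAt) renaming (_<_ to _<ᶠ_; _<?_ to _<ᶠ?_)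
open import Data.Fin.Properties using (any?; all?; toℕ<n; toℕ-↑ˡ; toℕ-↑ʳ; ↑ˡ-injective; ↑ʳ-injective; join-splitAt)
  renaming (_≟_ to _≟ᶠ_; <-irrefl to <ᶠ-irrefl; <-asym to <ᶠ-asym)
open import Data.Fin.Subset
  using (Subset; inside; outside; _∈_; _∉_; _⊆_; _∪_; _∩_; _-_; ∁; ⊥; ⁅_⁆; ∣_∣; Empty)
open import Data.Fin.Subset.Properties
  using (anySubset?; _⊆?_; _∈?_; nonempty?; in⊆in; out⊆; drop-∷-⊆; p⊆q⇒∣p∣≤∣q∣; ∣⁅x⁆∣≡1; ∣⊥∣≡0; ∉⊥; ⊆-refl;
         x∈p∪q⁺; x∈p∪q⁻; p∩q⊆q; x∈p∩q⁺; x∈p∩q⁻; ∣p∩q∣≤∣p∣; x∈⁅x⁆; x∈⁅y⁆⇒x≡y; x∉p⇒x∈∁p;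
         x∈p⇒∣p-x∣<∣p∣; x∈p∧x≢y⇒x∈p-y)
open import Data.List as List using (List; []; _∷_; _++_; length; map; lookup; allFin; cartesianProduct; take; drop)
open import Data.List.Membership.Propositional using () renaming (_∈_ to _∈ˡ_)
open import Data.List.Membership.Propositional.Properties
  using (∈-++⁺ˡ; ∈-++⁺ʳ; ∈-map⁺; ∈-map⁻; ∈-filter⁺; ∈-filter⁻; ∈-cartesianProduct⁺; ∈-allFin; ∈-lookup)
open import Data.List.Properties using (length-++; length-map; length-take; length-drop; length-tabulate; take++drop≡id)
open import Data.List.Relation.Unary.All as All using (All; []; _∷_)
open import Data.List.Relation.Unary.All.Properties using (++⁺)
open import Data.List.Relation.Unary.AllPairs using ([]; _∷_)
open import Data.List.Relation.Unary.Any as Any using (here; there)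
open import Data.List.Relation.Unary.Any.Properties using (lookup-index)
open import Data.List.Relation.Unary.Unique.Propositional using (Unique)
open import Data.List.Relation.Unary.Unique.Propositional.Properties
  using (filter⁺; allFin⁺; map⁺) renaming (cartesianProduct⁺ to cartesianProduct-unique)
open import Data.Nat
  using (ℕ; zero; suc; _+_; _*_; _∸_; _⊓_; _≤_; _<_; z≤n; s≤s; z<s; _/_; _%_; NonZero; >-nonZero⁻¹)
open import Data.Nat.Divisibility using (_∣_; _∤_; m%n≡0⇒n∣m)
open import Data.Nat.DivMod using (m≡m%n+[m/n]*n; m/n*n≡m; m*n/n≡m; m*n/m*o≡n/o; m%n<n; /-monoˡ-≤)
open import Data.Nat.Properties
open import Data.Nat.Tactic.RingSolver using (solve-∀)
open import Data.Product using (Σ-syntax; ∃-syntax; _×_; _,_; proj₁; proj₂; uncurry)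
open import Data.Product.Properties using (,-injectiveˡ; ,-injectiveʳ)
open import Data.Sum using (_⊎_; inj₁; inj₂)
open import Data.Vec as Vec using (Vec; []; _∷_)
open import Data.Vec.Properties
  using (lookup∘tabulate; lookup-++ˡ; lookup-++ʳ; lookup-zipWith; lookup-replicate; []=⇒lookup; lookup⇒[]=)
open import Function using (_∘_; id; case_of_; _⇔_; mk⇔; Equivalence)
open import Relation.Nullary using (¬_; Dec; yes; no; does; ¬?; contradiction; decidable-stable)
open import Relation.Nullary.Decidable using (_×-dec_; _⊎-dec_; _→-dec_; map′; dec-true)
open import Relation.Binary.PropositionalEquality
  using (_≡_; _≢_; refl; sym; trans; cong; cong₂; subst; module ≡-Reasoning)

-- The obstacle is a leaf that Breaker blocks from every slot on offer. Therefore each ordinary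
-- centre keeps one slot to the end: while the blocked edges are fewer than these slots, every leaf
-- and every centre has a free partner. The reserved stars cannot wait so long, since an exchange
-- needs them complete. While they are filled, blocked edges at their leaves survive and the backlog
-- may grow by `a` per round; but this takes boundedly many steps, so for large `n` the ordinary
-- centres still outnumber the blocked edges.
--
-- The time bound grants a single spare edge. If m leaves remain and b of their pairs are blocked, b
-- m ≤ a and b ≤ m force m + b ≤ a, except for m = a and b = 1. As every earlier move uses up
-- exactly `a` leaves, m = a happens only if `a` divides the number of leaves, which is the case
-- where the bound allows one more move.
--
-- Maker's plan is carried along the game tree rather than written as a function of the history.
-- Finite search turns it into such a function and also yields the least number of moves.

-- A Farkas certificate: it reduces a linear inequality to a semiring identity.
by-slack : ∀ {L R G H} s → L ≤ R → G + (R + s) ≡ H + L → G ≤ H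
by-slack {L} {R} {G} {H} s L≤R eq = +-cancelʳ-≤ R G H (begin
  G + R         ≤⟨ +-monoʳ-≤ G (m≤m+n R s) ⟩
  G + (R + s)   ≡⟨ eq ⟩
  H + L         ≤⟨ +-monoʳ-≤ H L≤R ⟩
  H + R         ∎)
  where open ≤-Reasoning

-- Sums over lists and removal of an entry

∑ : {A : Set} → (A → ℕ) → List A → ℕ
∑ f []       = 0
∑ f (x ∷ xs) = f x + ∑ f xs

data Split {A : Set} : List A → A → List A → Set where
  here  : ∀ {x xs} → Split (x ∷ xs) x xs
  there : ∀ {x z xs ys} → Split xs x ys → Split (z ∷ xs) x (z ∷ ys)

module _ {A : Set} where

  private
    interchange : ∀ a b c d → (a + b) + (c + d) ≡ (a + c) + (b + d)
    interchange = solve-∀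

    swap-left : ∀ a b c → a + (b + c) ≡ b + (a + c)
    swap-left = solve-∀

  ∑-cong : ∀ {f g : A → ℕ} → (∀ x → f x ≡ g x) → ∀ xs → ∑ f xs ≡ ∑ g xs
  ∑-cong f≗g []       = refl
  ∑-cong f≗g (x ∷ xs) = cong₂ _+_ (f≗g x) (∑-cong f≗g xs)

  ∑-mono : ∀ {f g : A → ℕ} → (∀ x → f x ≤ g x) → ∀ xs → ∑ f xs ≤ ∑ g xs
  ∑-mono f≤g []       = z≤n
  ∑-mono f≤g (x ∷ xs) = +-mono-≤ (f≤g x) (∑-mono f≤g xs)

  ∑-+ : ∀ (f g : A → ℕ) xs → ∑ (λ x → f x + g x) xs ≡ ∑ f xs + ∑ g xs
  ∑-+ f g []       = refl
  ∑-+ f g (x ∷ xs) = trans (cong (f x + g x +_) (∑-+ f g xs)) (interchange (f x) (g x) _ _)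

  ∑-*ˡ : ∀ k (f : A → ℕ) xs → ∑ (λ x → k * f x) xs ≡ k * ∑ f xs
  ∑-*ˡ k f []       = sym (*-zeroʳ k)
  ∑-*ˡ k f (x ∷ xs) = trans (cong (k * f x +_) (∑-*ˡ k f xs)) (sym (*-distribˡ-+ k (f x) _))

  ∑-0 : ∀ (xs : List A) → ∑ (λ _ → 0) xs ≡ 0
  ∑-0 []       = refl
  ∑-0 (_ ∷ xs) = ∑-0 xs

  ∑-1 : ∀ (xs : List A) → ∑ (λ _ → 1) xs ≡ length xs
  ∑-1 []       = refl
  ∑-1 (_ ∷ xs) = cong suc (∑-1 xs)

  ∑-const : ∀ k (xs : List A) → ∑ (λ _ → k) xs ≡ k * length xs
  ∑-const k []       = sym (*-zeroʳ k)
  ∑-const k (_ ∷ xs) = trans (cong (k +_) (∑-const k xs)) (sym (*-suc k (length xs)))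

  ∑-++ : ∀ (f : A → ℕ) xs ys → ∑ f (xs ++ ys) ≡ ∑ f xs + ∑ f ys
  ∑-++ f []       ys = refl
  ∑-++ f (x ∷ xs) ys = trans (cong (f x +_) (∑-++ f xs ys)) (sym (+-assoc (f x) _ _))

  ∑-swap : ∀ {B : Set} (f : A → B → ℕ) xs ys →
    ∑ (λ x → ∑ (f x) ys) xs ≡ ∑ (λ y → ∑ (λ x → f x y) xs) ys
  ∑-swap f []       ys = sym (trans (∑-const′ ys) refl)
    where
    ∑-const′ : ∀ ys → ∑ (λ _ → 0) ys ≡ 0
    ∑-const′ []       = refl
    ∑-const′ (_ ∷ ys) = ∑-const′ ys
  ∑-swap f (x ∷ xs) ys = trans (cong (∑ (f x) ys +_) (∑-swap f xs ys)) (sym (distr ys))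
    where
    distr : ∀ ys → ∑ (λ y → f x y + ∑ (λ z → f z y) xs) ys ≡ ∑ (f x) ys + ∑ (λ y → ∑ (λ z → f z y) xs) ys
    distr []       = refl
    distr (y ∷ ys) = trans (cong (f x y + _ +_) (distr ys)) (interchange (f x y) _ _ _)

  ∑-split : ∀ {x : A} {xs ys} → Split xs x ys → ∀ f → ∑ f xs ≡ f x + ∑ f ys
  ∑-split here              f = refl
  ∑-split (there {x} {z} s) f = trans (cong (f z +_) (∑-split s f)) (swap-left (f z) (f x) _)

  All-split : ∀ {P : A → Set} {x xs ys} → Split xs x ys → All P xs → P x × All P ys
  All-split here      (p ∷ ps) = p , ps
  All-split (there s) (p ∷ ps) = let q , qs = All-split s ps in q , p ∷ qs

  Split-length : ∀ {x : A} {xs ys} → Split xs x ys → length xs ≡ suc (length ys)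
  Split-length here      = refl
  Split-length (there s) = cong suc (Split-length s)

  length-cong : ∀ {xs ys : List A} → (∀ f → ∑ f xs ≡ ∑ f ys) → length xs ≡ length ys
  length-cong {xs} {ys} eq = trans (sym (∑-1 xs)) (trans (eq (λ _ → 1)) (∑-1 ys))

  find-positive : ∀ (f : A → ℕ) xs → 0 < ∑ f xs → ∃[ x ] ∃[ ys ] Split xs x ys × 0 < f x
  find-positive f (x ∷ xs) 0<∑ with f x in eq
  ... | suc _ = x , xs , here , subst (0 <_) (sym eq) z<s
  ... | zero  = let y , ys , s , 0<fy = find-positive f xs 0<∑ in y , x ∷ ys , there s , 0<fy

  find-zero : ∀ (f : A → ℕ) xs → ∑ f xs < length xs → ∃[ x ] ∃[ ys ] Split xs x ys × f x ≡ 0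
  find-zero f (x ∷ xs) ∑<n with f x in eq
  ... | zero  = x , xs , here , eq
  ... | suc m =
    let y , ys , s , fy = find-zero f xs (≤-<-trans (m≤n+m _ m) (≤-pred ∑<n))
    in y , x ∷ ys , there s , fy

  ∑≡0⇒All : ∀ (f : A → ℕ) xs → ∑ f xs ≡ 0 → All (λ x → f x ≡ 0) xs
  ∑≡0⇒All f []       _  = []
  ∑≡0⇒All f (x ∷ xs) eq = m+n≡0⇒m≡0 (f x) eq ∷ ∑≡0⇒All f xs (m+n≡0⇒n≡0 (f x) eq)

  find-≤ : ∀ (f g : A → ℕ) xs → 0 < length xs → ∑ f xs ≤ ∑ g xs → ∃[ x ] ∃[ ys ] Split xs x ys × f x ≤ g x
  find-≤ f g (x ∷ xs) _ ∑f≤∑g with f x ≤? g x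
  ... | yes fx≤gx = x , xs , here , fx≤gx
  find-≤ f g (x ∷ [])     _ ∑f≤∑g | no fx≰gx =
    contradiction (subst (_≤ g x + 0) (+-identityʳ (f x)) ∑f≤∑g) (λ le → fx≰gx (subst (f x ≤_) (+-identityʳ (g x)) le))
  find-≤ f g (x ∷ z ∷ xs) _ ∑f≤∑g | no fx≰gx =
    let y , ys , s , fy≤gy = find-≤ f g (z ∷ xs) z<s (+-cancelˡ-≤ (g x) _ _ (≤-trans (+-monoˡ-≤ _ (≰⇒≥ fx≰gx)) ∑f≤∑g))
    in y , x ∷ ys , there s , fy≤gy

-- Light matchings in a weighted bipartite graph

module Bipartite {Rw Cl : Set} (x : Rw → Cl → ℕ) where

  row : Rw → List Cl → ℕ
  row u cs = ∑ (x u) cs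

  col : List Rw → Cl → ℕ
  col us c = ∑ (λ u → x u c) us

  e : List Rw → List Cl → ℕ
  e us cs = ∑ (λ u → row u cs) us

  e-swap : ∀ us cs → e us cs ≡ ∑ (col us) cs
  e-swap us cs = ∑-swap x us cs

  e-splitʳ : ∀ us {c cs cs′} → Split cs c cs′ → e us cs ≡ col us c + e us cs′
  e-splitʳ us {c} {cs} {cs′} s = begin
    e us cs                    ≡⟨ e-swap us cs ⟩
    ∑ (col us) cs              ≡⟨ ∑-split s (col us) ⟩
    col us c + ∑ (col us) cs′  ≡⟨ cong (col us c +_) (e-swap us cs′) ⟨
    col us c + e us cs′        ∎
    where open ≡-Reasoning

  record Matching (us : List Rw) (cs : List Cl) : Set where
    field
      pairs   : List (Rw × Cl)
      rows    : ∀ f → ∑ (f ∘ proj₁) pairs ≡ ∑ f us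
      columns : ∀ f → ∑ (f ∘ proj₂) pairs ≡ ∑ f cs

    weight : ℕ
    weight = ∑ (λ (u , c) → x u c) pairs

  -- The partner of the first row is chosen so that the bound is met by the
  -- average over all completions.
  light-matching : ∀ us cs → length us ≡ length cs →
    Σ[ q ∈ Matching us cs ] Matching.weight q * length us ≤ e us cs
  light-matching []       []       _  = record { pairs = [] ; rows = λ f → refl ; columns = λ f → refl } , z≤n
  light-matching (u ∷ us) cs@(_ ∷ cs₁) |us|≡|cs| = q , bound
    where
    l H Γ : ℕ
    l = length us
    H = e us cs
    Γ = row u cs

    -- Pairing `u` with `c` and the rest lightly costs at most x u c + (H - col us c) / l, which
    -- should not exceed (Γ + H) / (l + 1). Multiplied by l (l + 1) and freed of the subtraction,
    -- this is F c ≤ G c. Both sides have the same sum over all columns, so some column satisfies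
    -- it.
    F G : Cl → ℕ
    F c = suc l * (l * x u c + H)
    G c = l * (Γ + H) + suc l * col us c

    ∑F≡∑G : ∑ F cs ≡ ∑ G cs
    ∑F≡∑G = begin
      ∑ F cs                                          ≡⟨ ∑-*ˡ (suc l) _ cs ⟩
      suc l * ∑ (λ c → l * x u c + H) cs              ≡⟨ cong (suc l *_) (∑-+ (λ c → l * x u c) (λ _ → H) cs) ⟩
      suc l * (∑ (λ c → l * x u c) cs + ∑ (λ _ → H) cs)
        ≡⟨ cong₂ (λ α β → suc l * (α + β)) (∑-*ˡ l (x u) cs) (trans (∑-const H cs) (cong (H *_) (sym |us|≡|cs|))) ⟩
      suc l * (l * Γ + H * suc l)                      ≡⟨ arith l Γ H ⟩
      l * (Γ + H) * suc l + suc l * H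
        ≡⟨ cong₂ _+_ (trans (∑-const (l * (Γ + H)) cs) (cong (l * (Γ + H) *_) (sym |us|≡|cs|)))
                     (trans (∑-*ˡ (suc l) _ cs) (cong (suc l *_) (sym (e-swap us cs)))) ⟨
      ∑ (λ _ → l * (Γ + H)) cs + ∑ (λ c → suc l * col us c) cs
        ≡⟨ ∑-+ (λ _ → l * (Γ + H)) (λ c → suc l * col us c) cs ⟨
      ∑ G cs                                           ∎
      where
      open ≡-Reasoning
      arith : ∀ l Γ H → suc l * (l * Γ + H * suc l) ≡ l * (Γ + H) * suc l + suc l * H
      arith = solve-∀

    choice : ∃[ c ] ∃[ cs′ ] Split cs c cs′ × F c ≤ G c
    choice = find-≤ F G cs z<s (≤-reflexive ∑F≡∑G)

    c = proj₁ choice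
    cs′ = proj₁ (proj₂ choice)
    s = proj₁ (proj₂ (proj₂ choice))
    Fc≤Gc = proj₂ (proj₂ (proj₂ choice))

    rest : Σ[ q ∈ Matching us cs′ ] Matching.weight q * length us ≤ e us cs′
    rest = light-matching us cs′ (suc-injective (trans |us|≡|cs| (Split-length s)))

    open Matching (proj₁ rest) renaming (pairs to pairs′; rows to rows′; columns to columns′; weight to b′)

    q : Matching (u ∷ us) cs
    q = record
      { pairs   = (u , c) ∷ pairs′
      ; rows    = λ f → cong (f u +_) (rows′ f)
      ; columns = λ f → trans (cong (f c +_) (columns′ f)) (sym (∑-split s f))
      }

    scaled : suc l * (l * x u c + e us cs′) ≤ l * (Γ + H)
    scaled = +-cancelʳ-≤ (suc l * col us c) _ _ (begin
      suc l * (l * x u c + e us cs′) + suc l * col us c    ≡⟨ lhs l (x u c) (e us cs′) (col us c) ⟩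
      suc l * (l * x u c + (col us c + e us cs′))          ≡⟨ cong (λ z → suc l * (l * x u c + z)) (e-splitʳ us s) ⟨
      F c                                                  ≤⟨ Fc≤Gc ⟩
      G c                                                  ∎)
      where
      open ≤-Reasoning
      lhs : ∀ l α e′ h → suc l * (l * α + e′) + suc l * h ≡ suc l * (l * α + (h + e′))
      lhs = solve-∀

    weightless : l ≡ 0 → b′ ≡ 0
    weightless l≡0 = none pairs′ (trans (trans (sym (∑-1 pairs′)) (trans (rows′ (λ _ → 1)) (∑-1 us))) l≡0)
      where
      none : ∀ (ps : List (Rw × Cl)) → length ps ≡ 0 → ∑ (λ (u , c) → x u c) ps ≡ 0
      none [] _ = refl

    cancel-l : ∀ l α b e′ → suc l * (l * α + e′) ≤ l * (Γ + H) → b * l ≤ e′ → (l ≡ 0 → b ≡ 0) → α ≤ Γ →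
      (α + b) * suc l ≤ Γ + H
    -- With no further rows the scaled inequality bounds only e′ and says nothing about α; here α ≤
    -- Γ is used instead.
    cancel-l zero    α b e′ _  _  b≡0 α≤Γ rewrite b≡0 refl | +-identityʳ α | *-identityʳ α = ≤-trans α≤Γ (m≤m+n Γ H)
    cancel-l (suc l) α b e′ le bl _   _   = *-cancelˡ-≤ (suc l) (begin
      suc l * ((α + b) * suc (suc l))              ≡⟨ regroup l α b ⟩
      suc (suc l) * (suc l * α + b * suc l)        ≤⟨ *-monoʳ-≤ (suc (suc l)) (+-monoʳ-≤ (suc l * α) bl) ⟩
      suc (suc l) * (suc l * α + e′)               ≤⟨ le ⟩
      suc l * (Γ + H)                              ∎)
      where
      open ≤-Reasoning
      regroup : ∀ l α b → suc l * ((α + b) * suc (suc l)) ≡ suc (suc l) * (suc l * α + b * suc l)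
      regroup = solve-∀

    bound : (x u c + b′) * suc l ≤ Γ + H
    bound = cancel-l l (x u c) b′ (e us cs′) scaled (proj₂ rest) weightless
      (≤-trans (m≤m+n (x u c) _) (≤-reflexive (sym (∑-split s (x u)))))

-- Maker's strategy on the leaf–centre graph

split? : ∀ {A : Set} (xs : List A) → xs ≡ [] ⊎ (∃[ x ] ∃[ ys ] Split xs x ys)
split? []       = inj₁ refl
split? (x ∷ xs) = inj₂ (x , xs , here)

-- Multisets are compared through the sums of all weight functions over them.

-- P consists of centres reserved for exchanges, C₀ of the other ones.  A slot
-- is a leaf still to be attached to a centre: each centre of C₀ owns one slot
-- besides those listed in A₀, each centre of P two.  As many as 2a + 1 of the
-- reserved stars may be blocked for v and another 2a + 1 for c when an
-- exchange is completed, hence the bound on P.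
record Setup : Set₁ where
  field
    {Rw Cl}   : Set
    Rows      : List Rw
    C₀ P A₀   : List Cl
    a κ       : ℕ
    complete  : ∀ f o → f o ≤ ∑ f C₀ + ∑ f P
    A₀-bound  : ∀ f → ∑ f A₀ ≤ κ * (∑ f C₀ + ∑ f P)
    balanced  : length Rows ≡ length A₀ + length C₀ + 2 * length P
    C₀-large  : suc κ * a + 2 * length P < length C₀
    P-large   : 4 * a + 3 ≤ length P

module Strategy (S : Setup) where
  open Setup S

  -- U: untouched leaves; A: open slots from A₀; C: centres of C₀ whose own
  -- slot is open; F, H, T: centres of P with none, one or both of their own
  -- slots filled, together with the leaves filling them; π: all other
  -- attached pairs.  W sums over the leaves in H and T.
  record State : Set where
    field
      U     : List Rw
      A F C : List Cl
      H π   : List (Rw × Cl)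
      T     : List (Cl × Rw × Rw)

    W : (Rw → ℕ) → ℕ
    W f = ∑ (f ∘ proj₁) H + ∑ (λ (_ , w , w′) → f w + f w′) T

    field
      rows  : ∀ f → ∑ f U + ∑ (f ∘ proj₁) π + W f ≡ ∑ f Rows
      slots : ∀ f → ∑ (f ∘ proj₂) π + ∑ f A + ∑ f C ≡ ∑ f A₀ + ∑ f C₀
      pool  : ∀ f → ∑ f F + ∑ (f ∘ proj₂) H + ∑ (f ∘ proj₁) T ≡ ∑ f P
      A⊆A₀  : ∀ f → ∑ f A ≤ ∑ f A₀
      C⊆C₀  : ∀ f → ∑ f C ≤ ∑ f C₀

    Idle Full : Set
    Idle = A ≡ [] × F ≡ [] × H ≡ []
    Full = ∀ f → ∑ f C ≡ ∑ f C₀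

    Held : (Rw × Cl → Set) → Set
    Held Own = All Own π × All Own H × All (λ (c , w , w′) → Own (w , c) × Own (w′ , c)) T

    pending : ℕ
    pending = 2 * length F + length H

  open State

  initial : State
  initial = record
    { U = Rows ; A = A₀ ; F = P ; C = C₀ ; H = [] ; π = [] ; T = []
    ; rows  = λ f → trans (+-identityʳ _) (+-identityʳ _)
    ; slots = λ f → refl
    ; pool  = λ f → trans (+-identityʳ _) (+-identityʳ _)
    ; A⊆A₀  = λ f → ≤-refl
    ; C⊆C₀  = λ f → ≤-refl
    }

  private
    shift-row : ∀ u U π W {V R} → V ≡ u + U → V + π + W ≡ R → U + (u + π) + W ≡ R
    shift-row u U π W refl eq = trans (arith u U π W) eq
      where
      arith : ∀ u U π W → U + (u + π) + W ≡ (u + U) + π + W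
      arith = solve-∀

    shift-half : ∀ u U π H T {V R} → V ≡ u + U → V + π + (H + T) ≡ R → U + π + ((u + H) + T) ≡ R
    shift-half u U π H T refl eq = trans (arith u U π H T) eq
      where
      arith : ∀ u U π H T → U + π + ((u + H) + T) ≡ (u + U) + π + (H + T)
      arith = solve-∀

    shift-triple : ∀ u U π w H T {V K R} → V ≡ u + U → K ≡ w + H → V + π + (K + T) ≡ R →
      U + π + (H + (w + u + T)) ≡ R
    shift-triple u U π w H T refl refl eq = trans (arith u U π w H T) eq
      where
      arith : ∀ u U π w H T → U + π + (H + (w + u + T)) ≡ (u + U) + π + ((w + H) + T)
      arith = solve-∀

    shift-slot : ∀ o π A C {B R} → B ≡ o + A → π + B + C ≡ R → (o + π) + A + C ≡ R
    shift-slot o π A C refl eq = trans (arith o π A C) eq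
      where
      arith : ∀ o π A C → (o + π) + A + C ≡ π + (o + A) + C
      arith = solve-∀

    shift-last-slot : ∀ o π A C {B R} → B ≡ o + C → π + A + B ≡ R → (o + π) + A + C ≡ R
    shift-last-slot o π A C refl eq = trans (arith o π A C) eq
      where
      arith : ∀ o π A C → (o + π) + A + C ≡ π + A + (o + C)
      arith = solve-∀

    shift-fresh : ∀ c F H T {B R} → B ≡ c + F → B + H + T ≡ R → F + (c + H) + T ≡ R
    shift-fresh c F H T refl eq = trans (arith c F H T) eq
      where
      arith : ∀ c F H T → F + (c + H) + T ≡ (c + F) + H + T
      arith = solve-∀

    shift-full : ∀ c F H T {B R} → B ≡ c + H → F + B + T ≡ R → F + H + (c + T) ≡ R
    shift-full c F H T refl eq = trans (arith c F H T) eq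
      where
      arith : ∀ c F H T → F + H + (c + T) ≡ F + (c + H) + T
      arith = solve-∀

    drop-≤ : ∀ {y z w} x → y ≡ x + z → y ≤ w → z ≤ w
    drop-≤ x refl le = ≤-trans (m≤n+m _ x) le

  fillA : ∀ st {u U′ o A′} → Split (U st) u U′ → Split (A st) o A′ → State
  fillA st {u} {U′} {o} {A′} su so = record st
    { U = U′ ; A = A′ ; π = (u , o) ∷ π st
    ; rows  = λ f → shift-row (f u) (∑ f U′) (∑ (f ∘ proj₁) (π st)) (W st f) (∑-split su f) (rows st f)
    ; slots = λ f → shift-slot (f o) (∑ (f ∘ proj₂) (π st)) (∑ f A′) (∑ f (C st)) (∑-split so f) (slots st f)
    ; A⊆A₀  = λ f → drop-≤ (f o) (∑-split so f) (A⊆A₀ st f)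
    }

  fillF : ∀ st {u U′ c F′} → Split (U st) u U′ → Split (F st) c F′ → State
  fillF st {u} {U′} {c} {F′} su sc = record st
    { U = U′ ; F = F′ ; H = (u , c) ∷ H st
    ; rows = λ f → shift-half (f u) (∑ f U′) (∑ (f ∘ proj₁) (π st)) (∑ (f ∘ proj₁) (H st))
        (∑ (λ (_ , w , w′) → f w + f w′) (T st)) (∑-split su f) (rows st f)
    ; pool = λ f → shift-fresh (f c) (∑ f F′) (∑ (f ∘ proj₂) (H st)) (∑ (f ∘ proj₁) (T st)) (∑-split sc f) (pool st f)
    }

  fillH : ∀ st {u U′ w c H′} → Split (U st) u U′ → Split (H st) (w , c) H′ → State
  fillH st {u} {U′} {w} {c} {H′} su sh = record st
    { U = U′ ; H = H′ ; T = (c , w , u) ∷ T st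
    ; rows = λ f → shift-triple (f u) (∑ f U′) (∑ (f ∘ proj₁) (π st)) (f w) (∑ (f ∘ proj₁) H′)
        (∑ (λ (_ , w , w′) → f w + f w′) (T st)) (∑-split su f) (∑-split sh (f ∘ proj₁)) (rows st f)
    ; pool = λ f → shift-full (f c) (∑ f (F st)) (∑ (f ∘ proj₂) H′) (∑ (f ∘ proj₁) (T st)) (∑-split sh (f ∘ proj₂)) (pool st f)
    }

  fillC : ∀ st {u U′ c C′} → Split (U st) u U′ → Split (C st) c C′ → State
  fillC st {u} {U′} {c} {C′} su sc = record st
    { U = U′ ; C = C′ ; π = (u , c) ∷ π st
    ; rows  = λ f → shift-row (f u) (∑ f U′) (∑ (f ∘ proj₁) (π st)) (W st f) (∑-split su f) (rows st f)
    ; slots = λ f → shift-last-slot (f c) (∑ (f ∘ proj₂) (π st)) (∑ f (A st)) (∑ f C′) (∑-split sc f) (slots st f)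
    ; C⊆C₀  = λ f → drop-≤ (f c) (∑-split sc f) (C⊆C₀ st f)
    }

  -- Leaves and slots are used up in pairs, so `balanced` persists.
  untouched : ∀ st → length (U st) ≡ length (A st) + pending st + length (C st)
  untouched st = arith (length (U st)) (length (π st)) (length (H st)) (length (T st)) (length Rows) (length (A st)) (length (C st))
    (length (F st)) (length P) (length A₀) (length C₀)
    rows₁ slots₁ pool₁ balanced
    where
    W₁ : W st (λ _ → 1) ≡ length (H st) + 2 * length (T st)
    W₁ = cong₂ _+_ (∑-1 (H st)) (∑-const 2 (T st))
    rows₁ : length (U st) + length (π st) + (length (H st) + 2 * length (T st)) ≡ length Rows
    rows₁ = trans (sym (cong₂ _+_ (cong₂ _+_ (∑-1 (U st)) (∑-1 (π st))) W₁)) (trans (rows st (λ _ → 1)) (∑-1 Rows))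
    slots₁ : length (π st) + length (A st) + length (C st) ≡ length A₀ + length C₀
    slots₁ = trans (sym (cong₂ _+_ (cong₂ _+_ (∑-1 (π st)) (∑-1 (A st))) (∑-1 (C st))))
      (trans (slots st (λ _ → 1)) (cong₂ _+_ (∑-1 A₀) (∑-1 C₀)))
    pool₁ : length (F st) + length (H st) + length (T st) ≡ length P
    pool₁ = trans (sym (cong₂ _+_ (cong₂ _+_ (∑-1 (F st)) (∑-1 (H st))) (∑-1 (T st)))) (trans (pool st (λ _ → 1)) (∑-1 P))
    arith : ∀ u p h t r al c f q a₀ c₀ → u + p + (h + 2 * t) ≡ r → p + al + c ≡ a₀ + c₀ → f + h + t ≡ q →
      r ≡ a₀ + c₀ + 2 * q → u ≡ al + (2 * f + h) + c
    arith u p h t r al c f q a₀ c₀ e₁ e₂ e₃ e₄ = +-cancelʳ-≡ (p + (h + 2 * t)) _ _ (begin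
      u + (p + (h + 2 * t))                              ≡⟨ +-assoc u p _ ⟨
      u + p + (h + 2 * t)                                ≡⟨ trans e₁ e₄ ⟩
      a₀ + c₀ + 2 * q                                    ≡⟨ cong₂ (λ y z → y + 2 * z) e₂ e₃ ⟨
      p + al + c + 2 * (f + h + t)                       ≡⟨ shuffle p al c f h t ⟩
      al + (2 * f + h) + c + (p + (h + 2 * t))           ∎)
      where
      open ≡-Reasoning
      shuffle : ∀ p al c f h t → p + al + c + 2 * (f + h + t) ≡ al + (2 * f + h) + c + (p + (h + 2 * t))
      shuffle = solve-∀

  Split-[] : ∀ {A : Set} {xs ys : List A} {z} → xs ≡ [] → ¬ Split xs z ys
  Split-[] refl ()

  Held-map : ∀ {Own Own′} st → (∀ p → Own p → Own′ p) → Held st Own → Held st Own′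
  Held-map st f (π-held , H-held , T-held) =
    All.map (f _) π-held , All.map (f _) H-held , All.map (λ (p , q) → f _ p , f _ q) T-held

  pending≤ : ∀ st → pending st ≤ 2 * length P
  pending≤ st = begin
    2 * length (F st) + length (H st)         ≤⟨ +-monoʳ-≤ (2 * length (F st)) (m≤n*m (length (H st)) 2) ⟩
    2 * length (F st) + 2 * length (H st)     ≡⟨ *-distribˡ-+ 2 (length (F st)) (length (H st)) ⟨
    2 * (length (F st) + length (H st))       ≤⟨ *-monoʳ-≤ 2 (m≤m+n (length (F st) + length (H st)) (length (T st))) ⟩
    2 * (length (F st) + length (H st) + length (T st))
      ≡⟨ cong (2 *_) (trans (sym (cong₂ _+_ (cong₂ _+_ (∑-1 (F st)) (∑-1 (H st))) (∑-1 (T st)))) (trans (pool st (λ _ → 1)) (∑-1 P))) ⟩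
    2 * length P                              ∎
    where open ≤-Reasoning

  -- Ownership stays abstract because the strategy is planned on leaf-centre pairs before these
  -- become claimed edges of the board; `Gain` describes what is owned afterwards.
  Gain : (Rw × Cl → Set) → List (Rw × Cl) → Rw × Cl → Set
  Gain Own G p = Own p ⊎ p ∈ˡ G

  -- Potentials, invariants and single steps

  module Position (x : Rw → Cl → ℕ) where
    open Bipartite x

    colW : State → Cl → ℕ
    colW st c = W st (λ w → x w c)

    -- One step may dispose of two edges counted by e U C, but only of one edge
    -- from U to P or from W to C.  Hence Φ tolerates one of these for each leaf
    -- and centre: any excess then is part of at least two edges counted by D.
    D Φ : State → ℕ
    D st = e (U st) (C st) + e (U st) P + ∑ (colW st) (C st)
    Φ st = e (U st) (C st) + ∑ (λ u → row u P ∸ 1) (U st) + ∑ (λ c → colW st c ∸ 1) (C st)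

    -- j is the number of steps left in Maker's current move; a Breaker move
    -- takes Inv 0 to Inv a.
    data Inv (j : ℕ) (st : State) : Set where
      early  : D st ≤ j → (∀ f → W st f ≡ 0) → Full st → Inv j st
      middle : D st + (length (A st) + pending st) + a < length (C st) + j → Idle st ⊎ Full st → Inv j st
      late   : Idle st → Φ st ≤ j → Inv j st

    D-fillA : ∀ st {u U′ o A′} (su : Split (U st) u U′) (so : Split (A st) o A′) →
      (row u (C st) + row u P) + D (fillA st su so) ≡ D st
    D-fillA st {u} {U′} su so = begin
      (row u (C st) + row u P) + (e U′ (C st) + e U′ P + ∑ (colW st) (C st))
        ≡⟨ arith (row u (C st)) (row u P) (e U′ (C st)) (e U′ P) (∑ (colW st) (C st)) ⟩
      (row u (C st) + e U′ (C st)) + (row u P + e U′ P) + ∑ (colW st) (C st)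
        ≡⟨ cong₂ (λ y z → y + z + ∑ (colW st) (C st)) (∑-split su _) (∑-split su _) ⟨
      D st ∎
      where
      open ≡-Reasoning
      arith : ∀ p q r s t → (p + q) + (r + s + t) ≡ (p + r) + (q + s) + t
      arith = solve-∀

    private
      -- A leaf `u` that joins a reserved star stays available for exchanges: its edges to `C` move
      -- from `e U C` into `colW`, and only those to `P` leave `D`. This is why filling the reserved
      -- stars need not reduce the backlog.
      D-pool : ∀ st st′ {u U′} → Split (U st) u U′ → U st′ ≡ U′ → C st′ ≡ C st →
        (∀ f → W st′ f ≡ f u + W st f) → row u P + D st′ ≡ D st
      D-pool st st′ {u} {U′} su refl refl W≡ = begin
        row u P + (e U′ (C st) + e U′ P + ∑ (colW st′) (C st))
          ≡⟨ cong (λ z → row u P + (e U′ (C st) + e U′ P + z))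
               (trans (∑-cong (λ c → W≡ (λ w → x w c)) (C st)) (∑-+ (x u) (colW st) (C st))) ⟩
        row u P + (e U′ (C st) + e U′ P + (row u (C st) + ∑ (colW st) (C st)))
          ≡⟨ arith (row u (C st)) (row u P) (e U′ (C st)) (e U′ P) (∑ (colW st) (C st)) ⟩
        (row u (C st) + e U′ (C st)) + (row u P + e U′ P) + ∑ (colW st) (C st)
          ≡⟨ cong₂ (λ y z → y + z + ∑ (colW st) (C st)) (∑-split su _) (∑-split su _) ⟨
        D st ∎
        where
        open ≡-Reasoning
        arith : ∀ p q r s t → q + (r + s + (p + t)) ≡ (p + r) + (q + s) + t
        arith = solve-∀

    D-fillF : ∀ st {u U′ c F′} (su : Split (U st) u U′) (sc : Split (F st) c F′) → D (fillF st su sc) ≤ D st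
    D-fillF st {u} su sc = ≤-trans (m≤n+m _ (row u P))
      (≤-reflexive (D-pool st (fillF st su sc) su refl refl (λ f → +-assoc (f u) _ _)))

    D-fillH : ∀ st {u U′ w c H′} (su : Split (U st) u U′) (sh : Split (H st) (w , c) H′) → D (fillH st su sh) ≤ D st
    D-fillH st {u} {U′} {w} {c} {H′} su sh = ≤-trans (m≤n+m _ (row u P))
      (≤-reflexive (D-pool st (fillH st su sh) su refl refl W≡))
      where
      arith : ∀ h w u t → h + (w + u + t) ≡ u + (w + h + t)
      arith = solve-∀
      W≡ : ∀ f → W (fillH st su sh) f ≡ f u + W st f
      W≡ f = trans (arith (∑ (f ∘ proj₁) H′) (f w) (f u) _)
        (cong (λ z → f u + (z + ∑ (λ (_ , w , w′) → f w + f w′) (T st))) (sym (∑-split sh (f ∘ proj₁))))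

    killD killΦ : State → Rw → List Rw → Cl → ℕ
    killD st u U′ c = row u (C st) + row u P + col U′ c + colW st c
    killΦ st u U′ c = row u (C st) + (row u P ∸ 1) + col U′ c + (colW st c ∸ 1)

    private
      e-split-both : ∀ {us u us′ cs c cs′} → Split us u us′ → Split cs c cs′ →
        row u cs + col us′ c + e us′ cs′ ≡ e us cs
      e-split-both {u = u} {us′} {cs} {c} {cs′} su sc =
        trans (+-assoc (row u cs) (col us′ c) (e us′ cs′))
          (trans (cong (row u cs +_) (sym (e-splitʳ us′ sc))) (sym (∑-split su _)))

      regroup : ∀ p r k v e′ Q C → (p + r + k + v) + (e′ + Q + C) ≡ (p + k + e′) + (r + Q) + (v + C)
      regroup = solve-∀

    D-fillC : ∀ st {u U′ c C′} (su : Split (U st) u U′) (sc : Split (C st) c C′) →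
      killD st u U′ c + D (fillC st su sc) ≡ D st
    D-fillC st {u} {U′} {c} {C′} su sc =
      trans (regroup (row u (C st)) (row u P) (col U′ c) (colW st c) (e U′ C′) (e U′ P) (∑ (colW st) C′))
        (cong₂ _+_ (cong₂ _+_ (e-split-both su sc) (sym (∑-split su _))) (sym (∑-split sc _)))

    Φ-fillC : ∀ st {u U′ c C′} (su : Split (U st) u U′) (sc : Split (C st) c C′) →
      killΦ st u U′ c + Φ (fillC st su sc) ≡ Φ st
    Φ-fillC st {u} {U′} {c} {C′} su sc =
      trans (regroup (row u (C st)) (row u P ∸ 1) (col U′ c) (colW st c ∸ 1) (e U′ C′)
               (∑ (λ u → row u P ∸ 1) U′) (∑ (λ c → colW st c ∸ 1) C′))
        (cong₂ _+_ (cong₂ _+_ (e-split-both su sc) (sym (∑-split su _))) (sym (∑-split sc _)))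

    row≤e : ∀ {us u us′} cs → Split us u us′ → row u cs ≤ e us cs
    row≤e cs su = ≤-trans (m≤m+n _ _) (≤-reflexive (sym (∑-split su (λ u → row u cs))))

    col≤e : ∀ us {cs c cs′} → Split cs c cs′ → col us c ≤ e us cs
    col≤e us sc = ≤-trans (m≤m+n _ _) (≤-reflexive (sym (e-splitʳ us sc)))

    record Pair (st : State) : Set where
      constructor pair
      field
        {u}  : Rw
        {U′} : List Rw
        {c}  : Cl
        {C′} : List Cl
        su   : Split (U st) u U′
        sc   : Split (C st) c C′
        free : x u c ≡ 0

    -- In the late phase `Φ` has to fall together with `j`. In the middle phase, once only `C` is
    -- open, |C| and `j` both fall by one, so `D` has to fall by two; for Φ ≤ 1 the late phase has
    -- been reached already.
    Heavy : ∀ st → Pair st → Set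
    Heavy st (pair {u} {U′} {c} _ _ _) = 1 ≤ killΦ st u U′ c × (2 ≤ Φ st → 2 ≤ killD st u U′ c)

    module _ (st : State) (e<U : e (U st) (C st) < length (U st)) (e<C : e (U st) (C st) < length (C st)) where

      partner-of-row : ∀ {u U′} → Split (U st) u U′ → ∃[ c ] ∃[ C′ ] Split (C st) c C′ × x u c ≡ 0
      partner-of-row {u} su = find-zero (x u) (C st) (≤-<-trans (row≤e (C st) su) e<C)

      partner-of-column : ∀ {c C′} → Split (C st) c C′ → ∃[ u ] ∃[ U′ ] Split (U st) u U′ × x u c ≡ 0
      partner-of-column {c} sc = find-zero (λ u → x u c) (U st) (≤-<-trans (col≤e (U st) sc) e<U)

      private
        2≤∸ : ∀ {n} → 0 < n ∸ 1 → 2 ≤ n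
        2≤∸ {suc (suc n)} _ = s≤s (s≤s z≤n)

        ≤₁ : ∀ {k p r q v} → k ≤ p → k ≤ p + r + q + v
        ≤₁ {k} {p} le = ≤-trans le (≤-trans (≤-trans (m≤m+n p _) (m≤m+n _ _)) (m≤m+n _ _))

        ≤₂ : ∀ {k r q v} p → k ≤ r → k ≤ p + r + q + v
        ≤₂ {k} {r} p le = ≤-trans le (≤-trans (≤-trans (m≤n+m r p) (m≤m+n _ _)) (m≤m+n _ _))

        ≤₁₃ : ∀ {k q v} p r → k ≤ p + q → k ≤ p + r + q + v
        ≤₁₃ {k} {q} {v} p r le = ≤-trans le (≤-trans (+-monoˡ-≤ q (m≤m+n p r)) (m≤m+n _ _))

        ≤₄ : ∀ {k p r q v} → k ≤ v → k ≤ p + r + q + v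
        ≤₄ {k} {p} {r} {q} {v} le = ≤-trans le (m≤n+m v (p + r + q))

      -- A leaf with two edges to `P`, or a centre with two edges from `W`, takes them along
      -- whatever its partner is. Otherwise Φ = e U C, and a leaf `u₁` blocked at two centres serves
      -- likewise. If `u₁` has only one blocked edge and another leaf is blocked at `c₂`, pairing
      -- `u₁` with `c₂` disposes of both edges; if that pair is itself blocked, `c₂` has two blocked
      -- edges and any free partner of `c₂` will do.
      heavy-pair : 0 < Φ st → Σ[ ρ ∈ Pair st ] Heavy st ρ
      heavy-pair 0<Φ with 0 <? ∑ (λ u → row u P ∸ 1) (U st) | 0 <? ∑ (λ c → colW st c ∸ 1) (C st)
      ... | yes 0<β | _ =
        let u , U′ , su , 0<r = find-positive _ (U st) 0<β
            c , C′ , sc , free = partner-of-row su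
        in pair su sc free , ≤₂ (row u (C st)) 0<r , λ _ → ≤₂ (row u (C st)) (2≤∸ 0<r)
      ... | no _ | yes 0<γ =
        let c , C′ , sc , 0<v = find-positive _ (C st) 0<γ
            u , U′ , su , free = partner-of-column sc
        in pair su sc free , ≤₄ {p = row u (C st)} 0<v , λ _ → ≤₄ {p = row u (C st)} (2≤∸ 0<v)
      ... | no β≯0 | no γ≯0 with find-positive (λ u → row u (C st)) (U st) 0<e
        where
        Φ≡e : Φ st ≡ e (U st) (C st)
        Φ≡e = trans (cong₂ (λ β γ → e (U st) (C st) + β + γ) (n≤0⇒n≡0 (≮⇒≥ β≯0)) (n≤0⇒n≡0 (≮⇒≥ γ≯0)))
                (trans (+-identityʳ _) (+-identityʳ _))
        0<e : 0 < e (U st) (C st)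
        0<e = subst (0 <_) Φ≡e 0<Φ
      ... | u₁ , U₁ , su₁ , 0<r₁ with 2 ≤? row u₁ (C st) | 0 <? e U₁ (C st)
      ... | yes 2≤r₁ | _ =
        let c , C′ , sc , free = partner-of-row su₁ in pair su₁ sc free , ≤₁ 0<r₁ , λ _ → ≤₁ 2≤r₁
      ... | no r₁≱2 | no e₁≯0 =
        let c , C′ , sc , free = partner-of-row su₁ in pair su₁ sc free , ≤₁ 0<r₁ , λ 2≤Φ → contradiction (subst (2 ≤_) Φ≡r₁ 2≤Φ) r₁≱2
        where
        Φ≡r₁ : Φ st ≡ row u₁ (C st)
        Φ≡r₁ = begin
          Φ st                          ≡⟨ cong₂ (λ β γ → e (U st) (C st) + β + γ) (n≤0⇒n≡0 (≮⇒≥ β≯0)) (n≤0⇒n≡0 (≮⇒≥ γ≯0)) ⟩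
          e (U st) (C st) + 0 + 0       ≡⟨ trans (+-identityʳ _) (+-identityʳ _) ⟩
          e (U st) (C st)               ≡⟨ ∑-split su₁ _ ⟩
          row u₁ (C st) + e U₁ (C st)   ≡⟨ cong (row u₁ (C st) +_) (n≤0⇒n≡0 (≮⇒≥ e₁≯0)) ⟩
          row u₁ (C st) + 0             ≡⟨ +-identityʳ _ ⟩
          row u₁ (C st)                 ∎
          where open ≡-Reasoning
      ... | no _ | yes 0<e₁ with find-positive (col U₁) (C st) (subst (0 <_) (e-swap U₁ (C st)) 0<e₁)
      ... | c₂ , C₂ , sc₂ , 0<k₂ with x u₁ c₂ ≟ 0
      ... | yes free = pair su₁ sc₂ free , ≤₁ 0<r₁ , λ _ → ≤₁₃ (row u₁ (C st)) _ (+-mono-≤ 0<r₁ 0<k₂)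
      ... | no taken with partner-of-column sc₂
      ... | u , U′ , su , free = pair su sc₂ free , ≤₁₃ (row u (C st)) _ (≤-trans (s≤s z≤n) 2≤k) , λ _ → ≤₁₃ (row u (C st)) _ 2≤k
        where
        2≤k : 2 ≤ row u (C st) + col U′ c₂
        2≤k = begin
          2                          ≤⟨ +-mono-≤ (n≢0⇒n>0 taken) 0<k₂ ⟩
          x u₁ c₂ + col U₁ c₂        ≡⟨ ∑-split su₁ _ ⟨
          col (U st) c₂              ≡⟨ ∑-split su _ ⟩
          x u c₂ + col U′ c₂         ≡⟨ cong (_+ col U′ c₂) free ⟩
          col U′ c₂                  ≤⟨ m≤n+m _ (row u (C st)) ⟩
          row u (C st) + col U′ c₂   ∎
          where open ≤-Reasoning

    record Move (st : State) (n j : ℕ) : Set₁ where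
      field
        claims    : List (Rw × Cl)
        #claims   : length claims ≡ n
        free      : All (λ (u , c) → x u c ≡ 0) claims
        next      : State
        held      : ∀ {Own} → Held st Own → Held next (Gain Own claims)
        invariant : Inv j next
        shrinks   : length (U st) ≡ n + length (U next)

    private
      gain₁ : ∀ {Own : Rw × Cl → Set} {p} q → Own q → Gain Own (p ∷ []) q
      gain₁ _ = inj₁

      new : ∀ {Own : Rw × Cl → Set} {p} → Gain Own (p ∷ []) p
      new = inj₂ (here refl)

    moveA : ∀ {j} st {u U′ o A′} (su : Split (U st) u U′) (so : Split (A st) o A′) → x u o ≡ 0 →
      Inv j (fillA st su so) → Move st 1 j
    moveA st {u} {o = o} su so free inv = record
      { claims = (u , o) ∷ [] ; #claims = refl ; free = free ∷ [] ; next = fillA st su so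
      ; held = λ {Own} h → let π-held , H-held , T-held = Held-map st gain₁ h in new {Own} ∷ π-held , H-held , T-held
      ; invariant = inv ; shrinks = Split-length su }

    moveF : ∀ {j} st {u U′ c F′} (su : Split (U st) u U′) (sc : Split (F st) c F′) → x u c ≡ 0 →
      Inv j (fillF st su sc) → Move st 1 j
    moveF st {u} {c = c} su sc free inv = record
      { claims = (u , c) ∷ [] ; #claims = refl ; free = free ∷ [] ; next = fillF st su sc
      ; held = λ {Own} h → let π-held , H-held , T-held = Held-map st gain₁ h in π-held , new {Own} ∷ H-held , T-held
      ; invariant = inv ; shrinks = Split-length su }

    moveH : ∀ {j} st {u U′ w c H′} (su : Split (U st) u U′) (sh : Split (H st) (w , c) H′) → x u c ≡ 0 →
      Inv j (fillH st su sh) → Move st 1 j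
    moveH st {u} {c = c} su sh free inv = record
      { claims = (u , c) ∷ [] ; #claims = refl ; free = free ∷ [] ; next = fillH st su sh
      ; held = λ {Own} h →
          let π-held , H-held , T-held = Held-map st gain₁ h
              w-held , H′-held = All-split sh H-held
          in π-held , H′-held , (w-held , new {Own}) ∷ T-held
      ; invariant = inv ; shrinks = Split-length su }

    moveC : ∀ {j} st (ρ : Pair st) → Inv j (fillC st (Pair.su ρ) (Pair.sc ρ)) → Move st 1 j
    moveC st (pair {u} {c = c} su sc free) inv = record
      { claims = (u , c) ∷ [] ; #claims = refl ; free = free ∷ [] ; next = fillC st su sc
      ; held = λ {Own} h → let π-held , H-held , T-held = Held-map st gain₁ h in new {Own} ∷ π-held , H-held , T-held
      ; invariant = inv ; shrinks = Split-length su }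

    e≤D : ∀ st → e (U st) (C st) ≤ D st
    e≤D st = ≤-trans (m≤m+n _ (e (U st) P)) (m≤m+n _ _)

    e≤Φ : ∀ st → e (U st) (C st) ≤ Φ st
    e≤Φ st = ≤-trans (m≤m+n _ (∑ (λ u → row u P ∸ 1) (U st))) (m≤m+n _ _)

    C≤U : ∀ st → length (C st) ≤ length (U st)
    C≤U st = ≤-trans (m≤n+m _ (length (A st) + pending st)) (≤-reflexive (sym (untouched st)))

    idle-balanced : ∀ st → Idle st → length (U st) ≡ length (C st)
    idle-balanced st idle = trans (untouched st) (cong (_+ length (C st)) (zeros st idle))
      where
      zeros : ∀ st → Idle st → length (A st) + pending st ≡ 0
      zeros record { A = _ ; F = _ ; H = _ } (refl , refl , refl) = refl

    full-length : ∀ st → Full st → length (C st) ≡ length C₀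
    full-length st full = length-cong {xs = C st} {C₀} full

    middle⇒D<C : ∀ {j} st → D st + (length (A st) + pending st) + a < length (C st) + j → j ≤ a → D st < length (C st)
    middle⇒D<C {j} st lt j≤a = +-cancelʳ-< a _ _ (begin-strict
      D st + a                                        ≤⟨ +-monoˡ-≤ a (m≤m+n (D st) _) ⟩
      D st + (length (A st) + pending st) + a         <⟨ lt ⟩
      length (C st) + j                               ≤⟨ +-monoʳ-≤ (length (C st)) j≤a ⟩
      length (C st) + a                               ∎)
      where open ≤-Reasoning

    -- While no own slot of `C₀` is filled, `D` covers the blocked edges from `U` to every centre,
    -- hence also those at the owner `o` of a slot outside `C`.
    partner-of-slot : ∀ st → Full st → D st < length (U st) → ∀ o → ∃[ u ] ∃[ U′ ] Split (U st) u U′ × x u o ≡ 0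
    partner-of-slot st full D<U o = find-zero (λ u → x u o) (U st) (≤-<-trans (begin
      col (U st) o                              ≤⟨ complete (col (U st)) o ⟩
      ∑ (col (U st)) C₀ + ∑ (col (U st)) P      ≡⟨ cong₂ _+_ (trans (sym (full _)) (sym (e-swap (U st) (C st)))) (sym (e-swap (U st) P)) ⟩
      e (U st) (C st) + e (U st) P              ≤⟨ m≤m+n _ _ ⟩
      D st                                      ∎) D<U)
      where open ≤-Reasoning

    private
      -- In `Full` mode a step fills one of the t open slots and spends one of the j steps, so it is
      -- enough that `D` does not grow.
      countdown : ∀ {d d′ t t′ c j} → d′ ≤ d → t ≡ suc t′ → d + t + a < c + suc j → d′ + t′ + a < c + j
      countdown {d} {d′} {t′ = t′} {c} {j} d′≤d refl lt = by-slack 0 (+-mono-≤ lt d′≤d) (arith d d′ t′ a c j)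
        where
        arith : ∀ d d′ t a c j →
          suc (d′ + t + a) + (c + suc j + d + 0) ≡ c + j + (suc (d + suc t + a) + d′)
        arith = solve-∀

      half-done : ∀ {f h f′ h′} → f ≡ suc f′ → h′ ≡ suc h → 2 * f + h ≡ suc (2 * f′ + h′)
      half-done {h = h} {f′} refl refl = arith f′ h
        where
        arith : ∀ f h → 2 * suc f + h ≡ suc (2 * f + suc h)
        arith = solve-∀

    -- The late invariant takes over at the first step with Φ ≤ j + 1, whichever invariant led
    -- there; before that Φ ≥ 2, and a heavy pair lowers `D` by two.
    idle-step : ∀ st j → Idle st → e (U st) (C st) < length (U st) →
      (Φ st ≤ suc j ⊎ D st + (length (A st) + pending st) + a < length (C st) + suc j) → Move st 1 j
    idle-step st j idle e<U potential with Φ st ≤? suc j | 0 <? Φ st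
    ... | yes Φ≤ | yes 0<Φ =
      let ρ , 1≤killΦ , _ = heavy-pair st e<U (<-≤-trans e<U (≤-reflexive (idle-balanced st idle))) 0<Φ
      in moveC st ρ (late idle (≤-pred (≤-trans (+-monoˡ-≤ _ 1≤killΦ)
           (≤-trans (≤-reflexive (Φ-fillC st (Pair.su ρ) (Pair.sc ρ))) Φ≤))))
    ... | yes Φ≤ | no Φ≯0 with split? (U st)
    ...   | inj₁ U≡[] = contradiction (subst (λ us → e (U st) (C st) < length us) U≡[] e<U) λ ()
    ...   | inj₂ (u , U′ , su) =
      let c , C′ , sc , free = partner-of-row st e<U (<-≤-trans e<U (≤-reflexive (idle-balanced st idle))) su
      in moveC st (pair su sc free) (late idle (begin
           Φ (fillC st su sc)                              ≤⟨ m≤n+m _ (killΦ st u U′ c) ⟩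
           killΦ st u U′ c + Φ (fillC st su sc)            ≡⟨ Φ-fillC st su sc ⟩
           Φ st                                            ≤⟨ ≮⇒≥ Φ≯0 ⟩
           0                                               ≤⟨ z≤n ⟩
           j                                               ∎))
      where open ≤-Reasoning
    idle-step st j idle e<U (inj₁ Φ≤) | no Φ≰ | _ = contradiction Φ≤ Φ≰
    idle-step st j idle e<U (inj₂ lt) | no Φ≰ | _ =
      let ρ , _ , 2≤killD = heavy-pair st e<U (<-≤-trans e<U (≤-reflexive (idle-balanced st idle))) (≤-<-trans z≤n (≰⇒> Φ≰))
      in moveC st ρ (middle (bound ρ (2≤killD (≤-trans (s≤s (s≤s z≤n)) (≰⇒> Φ≰)))) (inj₁ idle))
      where
      arith : ∀ d d′ t a c j → suc (d′ + t + a) + (suc c + suc j + d + 0) ≡ c + j + (suc (d + t + a) + (2 + d′))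
      arith = solve-∀
      bound : ∀ ρ → 2 ≤ killD st (Pair.u ρ) (Pair.U′ ρ) (Pair.c ρ) →
        D (fillC st (Pair.su ρ) (Pair.sc ρ)) + (length (A st) + pending st) + a < length (Pair.C′ ρ) + j
      bound (pair {u} {U′} {c} {C′} su sc free) 2≤kill = by-slack 0
        (+-mono-≤ (<-≤-trans lt (≤-reflexive (cong (_+ suc j) (Split-length sc))))
          (≤-trans (+-monoˡ-≤ (D (fillC st su sc)) 2≤kill) (≤-reflexive (D-fillC st su sc))))
        (arith (D st) (D (fillC st su sc)) (length (A st) + pending st) a (length C′) j)

    middle-step : ∀ st j → suc j ≤ a → D st + (length (A st) + pending st) + a < length (C st) + suc j →
      Idle st ⊎ Full st → Move st 1 j
    middle-step st j j≤a lt mode with split? (A st) | split? (F st) | split? (H st)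
    ... | inj₁ A≡[] | inj₁ F≡[] | inj₁ H≡[] =
      idle-step st j (A≡[] , F≡[] , H≡[])
        (<-≤-trans (≤-<-trans (e≤D st) (middle⇒D<C st lt j≤a)) (C≤U st)) (inj₂ lt)
    middle-step st j j≤a lt (inj₁ (A≡[] , _ , _)) | inj₂ (_ , _ , so) | _ | _ = contradiction so (Split-[] A≡[])
    middle-step st j j≤a lt (inj₁ (_ , F≡[] , _)) | _ | inj₂ (_ , _ , sc) | _ = contradiction sc (Split-[] F≡[])
    middle-step st j j≤a lt (inj₁ (_ , _ , H≡[])) | _ | _ | inj₂ (_ , _ , sh) = contradiction sh (Split-[] H≡[])
    middle-step st j j≤a lt (inj₂ full) | inj₂ (o , A′ , so) | _ | _ =
      let u , U′ , su , free = partner-of-slot st full (<-≤-trans (middle⇒D<C st lt j≤a) (C≤U st)) o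
      in moveA st su so free (middle (countdown
           (≤-trans (m≤n+m _ (row u (C st) + row u P)) (≤-reflexive (D-fillA st su so)))
           (cong (_+ pending st) (Split-length so)) lt) (inj₂ full))
    middle-step st j j≤a lt (inj₂ full) | _ | inj₂ (c , F′ , sc) | _ =
      let u , U′ , su , free = partner-of-slot st full (<-≤-trans (middle⇒D<C st lt j≤a) (C≤U st)) c
      in moveF st su sc free (middle (countdown (D-fillF st su sc)
           (trans (cong (length (A st) +_) (half-done {h = length (H st)} (Split-length sc) refl)) (+-suc (length (A st)) _)) lt) (inj₂ full))
    middle-step st j j≤a lt (inj₂ full) | _ | _ | inj₂ ((w , c) , H′ , sh) =
      let u , U′ , su , free = partner-of-slot st full (<-≤-trans (middle⇒D<C st lt j≤a) (C≤U st)) c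
      in moveH st su sh free (middle (countdown (D-fillH st su sh)
           (trans (cong (length (A st) +_) (trans (cong (2 * length (F st) +_) (Split-length sh)) (+-suc (2 * length (F st)) _)))
             (+-suc (length (A st)) _)) lt) (inj₂ full))

    -- `C₀-large` is made for this moment: the backlog is at most j, at most κ a slots of `A₀` and 2
    -- |P| slots of reserved centres are open, and the further `a` is the margin from which
    -- `middle⇒D<C` concludes.
    early⇒middle : ∀ st j → j ≤ a → D st ≤ j → Full st → length (A st) ≤ κ * a →
      D st + (length (A st) + pending st) + a < length (C st) + j
    early⇒middle st j j≤a D≤j full A≤κa = by-slack 0
      (+-mono-≤ (+-mono-≤ D≤j A≤κa) (+-mono-≤ (pending≤ st) (≤-trans C₀-large (≤-reflexive (sym (full-length st full))))))
      (arith (D st) (length (A st)) (pending st) a (length (C st)) j (length P) κ)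
      where
      arith : ∀ d l f a c j p κ →
        suc (d + (l + f) + a) + (j + κ * a + (2 * p + c) + 0) ≡ c + j + (d + l + (f + suc (suc κ * a + 2 * p)))
      arith = solve-∀

    -- With `W` empty, `D` is a sum over untouched leaves, so a backlog shows up at some leaf `u`,
    -- and attaching `u` to a free slot of `A` disposes of at least one edge. If `u` is blocked from
    -- all of `A`, its degree is at most `a` and, by `A₀-bound`, at least |A| / κ; hence |A| ≤ κ a
    -- and the middle phase can begin.
    early-step : ∀ st j → suc j ≤ a → D st ≤ suc j → (∀ f → W st f ≡ 0) → Full st → Move st 1 j
    early-step st j j≤a D≤j W≡0 full with 0 <? D st | split? (A st)
    ... | _ | inj₁ A≡[] =
      middle-step st j j≤a (early⇒middle st (suc j) j≤a D≤j full (≤-trans (≤-reflexive (cong length A≡[])) z≤n)) (inj₂ full)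
    ... | no D≯0 | inj₂ (o , A′ , so) =
      let u , U′ , su , free = partner-of-slot st full
            (≤-<-trans D≤j (≤-<-trans j≤a (≤-trans (≤-trans a<C₀ (≤-reflexive (sym (full-length st full)))) (C≤U st)))) o
      in moveA st su so free (early (≤-trans (≤-trans (m≤n+m _ (row u (C st) + row u P)) (≤-reflexive (D-fillA st su so)))
           (≤-trans (≮⇒≥ D≯0) z≤n)) W≡0 full)
      where
      a<C₀ : a < length C₀
      a<C₀ = ≤-<-trans (≤-trans (m≤m+n a (κ * a)) (m≤m+n _ (2 * length P))) C₀-large
    ... | yes 0<D | inj₂ _
      with find-positive (λ u → row u (C st) + row u P) (U st) (subst (0 <_) D≡ 0<D)
      where
      D≡ : D st ≡ ∑ (λ u → row u (C st) + row u P) (U st)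
      D≡ = trans (trans (cong (e (U st) (C st) + e (U st) P +_) (trans (∑-cong (λ c → W≡0 (λ w → x w c)) (C st)) (∑-0 (C st))))
             (+-identityʳ _)) (sym (∑-+ (λ u → row u (C st)) (λ u → row u P) (U st)))
    ... | u , U′ , su , 0<deg with row u (A st) <? length (A st)
    ... | yes row<A =
      let o , A′ , so , free = find-zero (x u) (A st) row<A
      in moveA st su so free (early (≤-pred (≤-trans (+-monoˡ-≤ _ 0<deg) (≤-trans (≤-reflexive (D-fillA st su so)) D≤j))) W≡0 full)
    ... | no row≮A =
      middle-step st j j≤a (early⇒middle st (suc j) j≤a D≤j full A≤) (inj₂ full)
      where
      A≤ : length (A st) ≤ κ * a
      A≤ = begin
        length (A st)                          ≤⟨ ≮⇒≥ row≮A ⟩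
        row u (A st)                           ≤⟨ A⊆A₀ st (x u) ⟩
        row u A₀                               ≤⟨ A₀-bound (x u) ⟩
        κ * (row u C₀ + row u P)               ≡⟨ cong (λ z → κ * (z + row u P)) (full (x u)) ⟨
        κ * (row u (C st) + row u P)           ≤⟨ *-monoʳ-≤ κ (≤-trans (+-mono-≤ (row≤e (C st) su) (row≤e P su)) (m≤m+n _ _)) ⟩
        κ * D st                               ≤⟨ *-monoʳ-≤ κ (≤-trans D≤j j≤a) ⟩
        κ * a                                  ∎
        where open ≤-Reasoning

    -- In the late phase blocked edges number at most Φ ≤ j + 1; having more leaves than that is
    -- what guarantees free partners.
    step : ∀ st j → suc j ≤ a → suc j < length (U st) → Inv (suc j) st → Move st 1 j
    step st j j≤a _   (early D≤ W≡0 full) = early-step st j j≤a D≤ W≡0 full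
    step st j j≤a _   (middle lt mode)    = middle-step st j j≤a lt mode
    step st j j≤a j<U (late idle Φ≤)      = idle-step st j idle (≤-<-trans (≤-trans (e≤Φ st) Φ≤) j<U) (inj₁ Φ≤)

    steps : ∀ j st → j ≤ a → j < length (U st) → Inv j st → Move st j 0
    steps zero st _ _ inv = record
      { claims = [] ; #claims = refl ; free = [] ; next = st ; held = λ h → Held-map st (λ _ → inj₁) h
      ; invariant = inv ; shrinks = refl }
    steps (suc j) st j≤a j<U inv = record
      { claims    = M₁.claims ++ M₂.claims
      ; #claims   = trans (length-++ M₁.claims) (cong₂ _+_ M₁.#claims M₂.#claims)
      ; free      = ++⁺ M₁.free M₂.free
      ; next      = M₂.next
      ; held      = λ {Own} h → Held-map M₂.next (λ _ → merge {Own}) (M₂.held (M₁.held {Own} h))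
      ; invariant = M₂.invariant
      ; shrinks   = trans M₁.shrinks (cong suc M₂.shrinks)
      }
      where
      module M₁ = Move (step st j j≤a j<U inv)
      module M₂ = Move (steps j M₁.next (≤-trans (n≤1+n j) j≤a) (≤-pred (subst (suc j <_) M₁.shrinks j<U)) M₁.invariant)
      merge : ∀ {Own : Rw × Cl → Set} {p} → Gain (Gain Own M₁.claims) M₂.claims p → Gain Own (M₁.claims ++ M₂.claims) p
      merge (inj₁ (inj₁ own)) = inj₁ own
      merge (inj₁ (inj₂ p∈)) = inj₂ (∈-++⁺ˡ p∈)
      merge (inj₂ p∈)        = inj₂ (∈-++⁺ʳ M₁.claims p∈)

-- The last two moves

module Repair (S : Setup) where
  open Setup S
  open Strategy S
  open State

  Triples : (Rw × Cl → Set) → List (Cl × Rw × Rw) → Set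
  Triples Own = All (λ (c , w , w′) → Own (w , c) × Own (w′ , c))

  record Finished (Own : Rw × Cl → Set) : Set where
    field
      pairs   : List (Rw × Cl)
      rows    : ∀ f → ∑ (f ∘ proj₁) pairs ≡ ∑ f Rows
      columns : ∀ f → ∑ (f ∘ proj₂) pairs ≡ ∑ f A₀ + ∑ f C₀ + 2 * ∑ f P
      owned   : All Own pairs

  Finished-map : ∀ {Own Own′} → (∀ {p} → Own p → Own′ p) → Finished Own → Finished Own′
  Finished-map f fin = record { Finished fin ; owned = All.map f (Finished.owned fin) }

  -- `q` is the part of an assignment still to be realised, `π` and the stars in `T` are the other
  -- part; only the stars in `T` are available for exchanges.
  record Partial (q π : List (Rw × Cl)) (T : List (Cl × Rw × Rw)) : Set where
    field
      rows    : ∀ f → ∑ (f ∘ proj₁) q + ∑ (f ∘ proj₁) π + ∑ (λ (_ , w , w′) → f w + f w′) T ≡ ∑ f Rows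
      columns : ∀ f → ∑ (f ∘ proj₂) q + ∑ (f ∘ proj₂) π + 2 * ∑ (f ∘ proj₁) T ≡ ∑ f A₀ + ∑ f C₀ + 2 * ∑ f P

  complete-partial : ∀ {Own π T} → Partial [] π T → All Own π → Triples Own T → Finished Own
  complete-partial {Own} {π} {T} partial π-owned T-owned = record
    { pairs   = π ++ flatten T
    ; rows    = λ f → trans (∑-++ (f ∘ proj₁) π (flatten T)) 
        (trans (cong (∑ (f ∘ proj₁) π +_) (∑-flatten (f ∘ proj₁) T)) (Partial.rows partial f))
    ; columns = λ f → trans (∑-++ (f ∘ proj₂) π (flatten T))
        (trans (cong (∑ (f ∘ proj₂) π +_) (trans (∑-flatten (f ∘ proj₂) T) 
          (trans (∑-+ (f ∘ proj₁) (f ∘ proj₁) T) (double (∑ (f ∘ proj₁) T))))) (Partial.columns partial f))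
    ; owned   = ++⁺ π-owned (flatten-owned T-owned)
    }
    where
    double : ∀ n → n + n ≡ 2 * n
    double = solve-∀
    flatten : List (Cl × Rw × Rw) → List (Rw × Cl)
    flatten []                 = []
    flatten ((c , w , w′) ∷ T) = (w , c) ∷ (w′ , c) ∷ flatten T
    ∑-flatten : ∀ g T → ∑ g (flatten T) ≡ ∑ (λ (c , w , w′) → g (w , c) + g (w′ , c)) T
    ∑-flatten g []                 = refl
    ∑-flatten g ((c , w , w′) ∷ T) = trans (cong (λ z → g (w , c) + (g (w′ , c) + z)) (∑-flatten g T)) (sym (+-assoc (g (w , c)) _ _))
    flatten-owned : ∀ {T} → Triples Own T → All Own (flatten T)
    flatten-owned []              = []
    flatten-owned ((p , q) ∷ pqs) = p ∷ q ∷ flatten-owned pqs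

  claim-pair : ∀ {u c q π T} → Partial ((u , c) ∷ q) π T → Partial q ((u , c) ∷ π) T
  claim-pair {u} {c} {q} {π} {T} partial = record
    { rows    = λ f → trans (arith (f u) (∑ (f ∘ proj₁) q) (∑ (f ∘ proj₁) π) _) (Partial.rows partial f)
    ; columns = λ f → trans (arith (f c) (∑ (f ∘ proj₂) q) (∑ (f ∘ proj₂) π) _) (Partial.columns partial f)
    }
    where
    arith : ∀ u q π t → q + (u + π) + t ≡ u + q + π + t
    arith = solve-∀

  -- The leaf w moves from the pool centre c′ to c, and v takes its place.
  reroute : ∀ {v c c′ w w′ q π T T′} → Split T (c′ , w , w′) T′ → Partial ((v , c) ∷ q) π T →
    Partial q ((v , c′) ∷ (w , c) ∷ (w′ , c′) ∷ π) T′
  reroute {v} {c} {c′} {w} {w′} {q} {π} {T} {T′} s partial = record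
    { rows    = λ f → trans (arith (f v) (f w) (f w′) (∑ (f ∘ proj₁) q) (∑ (f ∘ proj₁) π) (∑ (λ (_ , w , w′) → f w + f w′) T′))
        (trans (cong (∑ (f ∘ proj₁) ((v , c) ∷ q) + ∑ (f ∘ proj₁) π +_)
          (sym (∑-split s (λ (_ , w , w′) → f w + f w′)))) (Partial.rows partial f))
    ; columns = λ f → trans (arith₂ (f c′) (f c) (∑ (f ∘ proj₂) q) (∑ (f ∘ proj₂) π) (∑ (f ∘ proj₁) T′))
        (trans (cong (λ z → ∑ (f ∘ proj₂) ((v , c) ∷ q) + ∑ (f ∘ proj₂) π + 2 * z)
          (sym (∑-split s (f ∘ proj₁)))) (Partial.columns partial f))
    }
    where
    arith : ∀ v w w′ q π t → q + (v + (w + (w′ + π))) + t ≡ v + q + π + (w + w′ + t)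
    arith = solve-∀
    arith₂ : ∀ c′ c q π t → q + (c′ + (c + (c′ + π))) + 2 * t ≡ c + q + π + 2 * (c′ + t)
    arith₂ = solve-∀

  swap-leaves : ∀ {c w w′ q π T T′} → Split T (c , w , w′) T′ → Partial q π T → Partial q π ((c , w′ , w) ∷ T′)
  swap-leaves {c} {w} {w′} {q} {π} {T′ = T′} s partial = record
    { rows    = λ f → trans (cong (∑ (f ∘ proj₁) q + ∑ (f ∘ proj₁) π +_)
        (trans (cong (_+ ∑ (λ (_ , w , w′) → f w + f w′) T′) (+-comm (f w′) (f w)))
        (sym (∑-split s (λ (_ , w , w′) → f w + f w′))))) (Partial.rows partial f)
    ; columns = λ f → trans (cong (λ z → ∑ (f ∘ proj₂) q + ∑ (f ∘ proj₂) π + 2 * z) (sym (∑-split s (f ∘ proj₁)))) (Partial.columns partial f)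
    }

  record Finishing (Holds : (Rw × Cl → Set) → Set) (x : Rw → Cl → ℕ) (n : ℕ) : Set₁ where
    field
      claims   : List (Rw × Cl)
      #claims≤ : length claims ≤ n
      free     : All (λ (u , c) → x u c ≡ 0) claims
      finished : ∀ {Own} → Holds Own → Finished (Gain Own claims)

  Finishing-≤ : ∀ {Holds x m n} → m ≤ n → Finishing Holds x m → Finishing Holds x n
  Finishing-≤ m≤n fin = record { Finishing fin ; #claims≤ = ≤-trans (Finishing.#claims≤ fin) m≤n }

  module Rerouting (x : Rw → Cl → ℕ) where
    open Bipartite x
    open Position x

    rowT : Rw → List (Cl × Rw × Rw) → ℕ
    rowT u = ∑ (λ (c , _ , _) → x u c)

    colT : Cl → List (Cl × Rw × Rw) → ℕ
    colT c = ∑ (λ (_ , w , w′) → x w c + x w′ c)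

    record Reroute (v : Rw) (c : Cl) (T : List (Cl × Rw × Rw)) : Set where
      field
        {c′}   : Cl
        {w w′} : Rw
        {T′}   : List (Cl × Rw × Rw)
        s      : Split T (c′ , w , w′) T′
        v-free : x v c′ ≡ 0
        w-free : x w c ≡ 0
        w′-free : x w′ c ≡ 0

    -- An unusable star contributes to one of the two sums. Both of its leaves are required to be
    -- free at `c`, so that a postponed exchange keeps two candidates.
    find-reroute : ∀ v c T → rowT v T + colT c T < length T → Reroute v c T
    find-reroute v c T lt =
      let (c′ , w , w′) , T′ , s , eq = find-zero (λ (c′ , w , w′) → x v c′ + (x w c + x w′ c)) T
            (subst (_< length T) (sym (∑-+ (λ (c′ , _ , _) → x v c′) (λ (_ , w , w′) → x w c + x w′ c) T)) lt)
          eq′ = m+n≡0⇒n≡0 (x v c′) eq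
      in record { s = s ; v-free = m+n≡0⇒m≡0 (x v c′) eq ; w-free = m+n≡0⇒m≡0 (x w c) eq′ ; w′-free = m+n≡0⇒n≡0 (x w c) eq′ }

    ∸1≤⇒≤ : ∀ {m B} → m ∸ 1 ≤ B → m ≤ suc B
    ∸1≤⇒≤ {zero}  _  = z≤n
    ∸1≤⇒≤ {suc m} le = s≤s le

    enough : ∀ {r k B l t} → r ≤ suc B → k ≤ suc B → 2 * B + 2 + suc l ≤ t → r + k < t
    enough {r} {k} {B} {l} {t} r≤ k≤ le = by-slack l (+-mono-≤ (+-mono-≤ r≤ k≤) le) (arith r k B l t)
      where
      arith : ∀ r k B l t → suc (r + k) + (suc B + suc B + t + l) ≡ t + (r + k + (2 * B + 2 + suc l))
      arith = solve-∀

    weight : List (Rw × Cl) → ℕ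
    weight = ∑ (λ (u , c) → x u c)

    -- A free pair costs one claim, a blocked pair two claims and one reserved star. As the excesses
    -- over one sum to at most B, each leaf and each centre in `q` is blocked from at most B + 1
    -- stars, so 2 B + 2 + |q| stars last to the end.
    resolve : ∀ B q π T → Partial q π T →
      ∑ (λ (u , _) → rowT u T ∸ 1) q ≤ B → ∑ (λ (_ , c) → colT c T ∸ 1) q ≤ B → 2 * B + 2 + length q ≤ length T →
      Finishing (λ Own → All Own π × Triples Own T) x (length q + weight q)
    resolve B [] π T partial _ _ _ = record
      { claims = [] ; #claims≤ = z≤n ; free = []
      ; finished = λ (π-owned , T-owned) → Finished-map inj₁ (complete-partial partial π-owned T-owned) }
    resolve B ((v , c) ∷ q) π T partial rows≤ cols≤ T-large with x v c ≟ 0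
    ... | yes free = record
      { claims   = (v , c) ∷ claims rest
      ; #claims≤ = s≤s (≤-trans (#claims≤ rest) (+-monoʳ-≤ (length q) (m≤n+m _ (x v c))))
      ; free     = free ∷ Finishing.free rest
      ; finished = λ {Own} (π-owned , T-owned) → Finished-map (merge {Own})
          (finished rest {Gain Own ((v , c) ∷ [])}
            (inj₂ (here refl) ∷ All.map inj₁ π-owned , All.map (λ (p , q) → inj₁ p , inj₁ q) T-owned))
      }
      where
      open Finishing hiding (free)
      rest : Finishing (λ Own → All Own ((v , c) ∷ π) × Triples Own T) x (length q + weight q)
      rest = resolve B q ((v , c) ∷ π) T (claim-pair partial)
        (≤-trans (m≤n+m _ (rowT v T ∸ 1)) rows≤) (≤-trans (m≤n+m _ (colT c T ∸ 1)) cols≤)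
        (≤-trans (+-monoʳ-≤ (2 * B + 2) (n≤1+n (length q))) T-large)
      merge : ∀ {Own : Rw × Cl → Set} {p} → Gain (Gain Own ((v , c) ∷ [])) (claims rest) p → Gain Own ((v , c) ∷ claims rest) p
      merge (inj₁ (inj₁ own))        = inj₁ own
      merge (inj₁ (inj₂ (here eq)))  = inj₂ (here eq)
      merge (inj₂ p∈)                = inj₂ (there p∈)
    ... | no taken = record
      { claims   = (v , c′) ∷ (w , c) ∷ claims rest
      ; #claims≤ = count (length q) (weight q) (n≢0⇒n>0 taken) (#claims≤ rest)
      ; free     = v-free ∷ w-free ∷ Finishing.free rest
      ; finished = λ {Own} (π-owned , T-owned) →
          let (_ , w′-owned) , T′-owned = All-split s T-owned
          in Finished-map (merge {Own}) (finished rest {Gain Own ((v , c′) ∷ (w , c) ∷ [])}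
            (inj₂ (here refl) ∷ inj₂ (there (here refl)) ∷ inj₁ w′-owned ∷ All.map inj₁ π-owned ,
             All.map (λ (p , q) → inj₁ p , inj₁ q) T′-owned))
      }
      where
      open Finishing hiding (free)
      open Reroute (find-reroute v c T (enough {rowT v T} {colT c T} {B = B} {l = length q}
        (∸1≤⇒≤ (≤-trans (m≤m+n (rowT v T ∸ 1) _) rows≤)) (∸1≤⇒≤ (≤-trans (m≤m+n (colT c T ∸ 1) _) cols≤)) T-large))
      shorter : ∀ f → ∑ f T′ ≤ ∑ f T
      shorter f = ≤-trans (m≤n+m _ (f (c′ , w , w′))) (≤-reflexive (sym (∑-split s f)))
      rest : Finishing (λ Own → All Own ((v , c′) ∷ (w , c) ∷ (w′ , c′) ∷ π) × Triples Own T′) x (length q + weight q)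
      rest = resolve B q _ T′ (reroute s partial)
        (≤-trans (∑-mono (λ _ → ∸-monoˡ-≤ 1 (shorter _)) q) (≤-trans (m≤n+m _ (rowT v T ∸ 1)) rows≤))
        (≤-trans (∑-mono (λ _ → ∸-monoˡ-≤ 1 (shorter _)) q) (≤-trans (m≤n+m _ (colT c T ∸ 1)) cols≤))
        (≤-pred (≤-trans (≤-reflexive (sym (+-suc (2 * B + 2) (length q)))) (≤-trans T-large (≤-reflexive (Split-length s)))))
      count : ∀ l b {y n} → 1 ≤ y → n ≤ l + b → suc (suc n) ≤ suc l + (y + b)
      count l b {y} {n} 1≤y n≤ = by-slack 0 (+-mono-≤ 1≤y n≤) (arith l b y n)
        where
        arith : ∀ l b y n → suc (suc n) + (y + (l + b) + 0) ≡ suc l + (y + b) + (1 + n)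
        arith = solve-∀
      merge : ∀ {Own : Rw × Cl → Set} {p} → Gain (Gain Own ((v , c′) ∷ (w , c) ∷ [])) (claims rest) p →
        Gain Own ((v , c′) ∷ (w , c) ∷ claims rest) p
      merge (inj₁ (inj₁ own))                = inj₁ own
      merge (inj₁ (inj₂ (here eq)))          = inj₂ (here eq)
      merge (inj₁ (inj₂ (there (here eq))))  = inj₂ (there (here eq))
      merge (inj₂ p∈)                        = inj₂ (there (there p∈))

module Endgame (S : Setup) (x : Setup.Rw S → Setup.Cl S → ℕ) where
  open Setup S
  open Strategy S
  open State
  open Repair S
  open Bipartite x
  open Position x
  open Rerouting x

  -- Between the last two moves the assignment lacks only the pair (v , c). The edge from `v` to the
  -- reserved centre is kept apart in `Awaiting`, and `T″` still contains that star whole, so the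
  -- next move may complete this exchange or choose another.
  record Pending : Set where
    field
      {v}     : Rw
      {c}     : Cl
      {π′}    : List (Rw × Cl)
      {T″}    : List (Cl × Rw × Rw)
      partial : Partial ((v , c) ∷ []) π′ T″
      poolT   : ∀ f → ∑ (f ∘ proj₁) T″ ≡ ∑ f P
      row≤    : rowT v T″ ≤ suc a
      col≤    : colT c T″ ≤ suc a
      reroute-of-v : Reroute v c T″

    Awaiting : (Rw × Cl → Set) → Set
    Awaiting Own = Own (v , Reroute.c′ reroute-of-v) × All Own π′ × Triples Own T″

    Awaiting-map : ∀ {Own Own′} → (∀ p → Own p → Own′ p) → Awaiting Own → Awaiting Own′
    Awaiting-map f (v-owned , π-owned , T-owned) =
      f _ v-owned , All.map (f _) π-owned , All.map (λ (p , q) → f _ p , f _ q) T-owned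

  record Postponing (st : State) : Set₁ where
    field
      pending′ : Pending
      claims   : List (Rw × Cl)
      #claims≤ : length claims ≤ a
      free     : All (λ (u , c) → x u c ≡ 0) claims
      awaits   : ∀ {Own} → Held st Own → Pending.Awaiting pending′ (Gain Own claims)

  -- For b and m at least 2, (b - 1) (m - 1) ≥ 1 gives m + b ≤ b * m ≤ a, and `b ≤ m` rules out b ≥
  -- 2 with a smaller m. A single blocked pair fits unless m = a.
  few-blocked : ∀ b m → b * m ≤ a → b ≤ m → m ≤ a → m + b ≤ a ⊎ (m ≡ a × b ≡ 1)
  few-blocked zero m _ _ m≤a = inj₁ (≤-trans (≤-reflexive (+-identityʳ m)) m≤a)
  few-blocked (suc zero) m _ _ m≤a with m≤n⇒m<n∨m≡n m≤a
  ... | inj₁ m<a = inj₁ (≤-trans (≤-reflexive (+-comm m 1)) m<a)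
  ... | inj₂ m≡a = inj₂ (m≡a , refl)
  few-blocked (suc (suc b)) (suc (suc m)) bm≤a _ _ = inj₁ (by-slack (b + m + b * m) bm≤a (arith b m a))
    where
    arith : ∀ b m a → suc (suc m) + suc (suc b) + (a + (b + m + b * m)) ≡ a + suc (suc b) * suc (suc m)
    arith = solve-∀
  few-blocked (suc (suc b)) (suc zero) _ (s≤s ()) _

  module _ (x≤1 : ∀ u c → x u c ≤ 1) (st : State) (idle : Idle st) (Φ≤a : Φ st ≤ a) (U≤a : length (U st) ≤ a)
    (q : Matching (U st) (C st)) (light : Matching.weight q * length (U st) ≤ e (U st) (C st)) where

    private
      open Matching q using (pairs) renaming (rows to q-rows; columns to q-columns)

      W-idle : ∀ f → W st f ≡ ∑ (λ (_ , w , w′) → f w + f w′) (T st)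
      W-idle f = cong (λ h → ∑ (f ∘ proj₁) h + ∑ (λ (_ , w , w′) → f w + f w′) (T st)) (proj₂ (proj₂ idle))

      pool-idle : ∀ f → ∑ (f ∘ proj₁) (T st) ≡ ∑ f P
      pool-idle f = trans (sym (cong₂ (λ s h → ∑ f s + ∑ (f ∘ proj₂) h + ∑ (f ∘ proj₁) (T st))
        (proj₁ (proj₂ idle)) (proj₂ (proj₂ idle)))) (pool st f)

      slots-idle : ∀ f → ∑ f (C st) + ∑ (f ∘ proj₂) (π st) ≡ ∑ f A₀ + ∑ f C₀
      slots-idle f = begin
        ∑ f (C st) + ∑ (f ∘ proj₂) (π st)                  ≡⟨ +-comm (∑ f (C st)) _ ⟩
        ∑ (f ∘ proj₂) (π st) + ∑ f (C st)                  ≡⟨ cong (_+ ∑ f (C st)) (+-identityʳ _) ⟨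
        ∑ (f ∘ proj₂) (π st) + ∑ f [] + ∑ f (C st)         ≡⟨ cong (λ s → ∑ (f ∘ proj₂) (π st) + ∑ f s + ∑ f (C st)) (proj₁ idle) ⟨
        ∑ (f ∘ proj₂) (π st) + ∑ f (A st) + ∑ f (C st)     ≡⟨ slots st f ⟩
        ∑ f A₀ + ∑ f C₀                                    ∎
        where open ≡-Reasoning

      start : Partial pairs (π st) (T st)
      start = record
        { rows    = λ f → trans (cong₂ (λ y z → y + ∑ (f ∘ proj₁) (π st) + z) (q-rows f) (sym (W-idle f))) (rows st f)
        ; columns = λ f → trans (cong₂ (λ y z → y + ∑ (f ∘ proj₂) (π st) + 2 * z) (q-columns f) (pool-idle f))
            (cong (_+ 2 * ∑ f P) (slots-idle f))
        }

      |q|≡|U| : length pairs ≡ length (U st)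
      |q|≡|U| = trans (sym (∑-1 pairs)) (trans (q-rows (λ _ → 1)) (∑-1 (U st)))

      colT≡colW : ∀ c → colT c (T st) ≡ colW st c
      colT≡colW c = sym (W-idle (λ w → x w c))

      rows≤ : ∑ (λ (u , _) → rowT u (T st) ∸ 1) pairs ≤ a
      rows≤ = begin
        ∑ (λ (u , _) → rowT u (T st) ∸ 1) pairs   ≡⟨ q-rows (λ u → rowT u (T st) ∸ 1) ⟩
        ∑ (λ u → rowT u (T st) ∸ 1) (U st)        ≡⟨ ∑-cong (λ u → cong (_∸ 1) (pool-idle (x u))) (U st) ⟩
        ∑ (λ u → row u P ∸ 1) (U st)              ≤⟨ ≤-trans (m≤n+m _ (e (U st) (C st))) (m≤m+n _ _) ⟩
        Φ st                                      ≤⟨ Φ≤a ⟩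
        a                                         ∎
        where open ≤-Reasoning

      cols≤ : ∑ (λ (_ , c) → colT c (T st) ∸ 1) pairs ≤ a
      cols≤ = begin
        ∑ (λ (_ , c) → colT c (T st) ∸ 1) pairs   ≡⟨ q-columns (λ c → colT c (T st) ∸ 1) ⟩
        ∑ (λ c → colT c (T st) ∸ 1) (C st)        ≡⟨ ∑-cong (λ c → cong (_∸ 1) (colT≡colW c)) (C st) ⟩
        ∑ (λ c → colW st c ∸ 1) (C st)            ≤⟨ m≤n+m _ (e (U st) (C st) + ∑ (λ u → row u P ∸ 1) (U st)) ⟩
        Φ st                                      ≤⟨ Φ≤a ⟩
        a                                         ∎
        where open ≤-Reasoning

      |T|≡|P| : length (T st) ≡ length P
      |T|≡|P| = trans (sym (∑-1 (T st))) (trans (pool-idle (λ _ → 1)) (∑-1 P))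

      T-large : ∀ {l} → l ≤ suc (2 * a) → 2 * a + 2 + l ≤ length (T st)
      T-large {l} l≤ = by-slack 0 (+-mono-≤ (≤-trans P-large (≤-reflexive (sym |T|≡|P|))) l≤) (arith a l (length (T st)))
        where
        arith : ∀ a l t → 2 * a + 2 + l + (t + suc (2 * a) + 0) ≡ t + (4 * a + 3 + l)
        arith = solve-∀

      weight≤ : weight pairs ≤ length (U st)
      weight≤ = ≤-trans (∑-mono (λ (u , c) → x≤1 u c) pairs) (≤-reflexive (trans (∑-1 pairs) |q|≡|U|))

      v-row : ∀ {v c q′} → Split pairs (v , c) q′ → rowT v (T st) ≤ suc a
      v-row {v} s = ∸1≤⇒≤ (≤-trans (m≤m+n (rowT v (T st) ∸ 1) _)
        (≤-trans (≤-reflexive (sym (∑-split s (λ (u , _) → rowT u (T st) ∸ 1)))) rows≤))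

      c-col : ∀ {v c q′} → Split pairs (v , c) q′ → colT c (T st) ≤ suc a
      c-col {c = c} s = ∸1≤⇒≤ (≤-trans (m≤m+n (colT c (T st) ∸ 1) _)
        (≤-trans (≤-reflexive (sym (∑-split s (λ (_ , c) → colT c (T st) ∸ 1)))) cols≤))

      regroup : ∀ v q π t {qπ vq s} → qπ ≡ q + π → vq ≡ v + q → vq + π + t ≡ s → v + 0 + qπ + t ≡ s
      regroup v q π t refl refl eq = trans (arith v q π t) eq
        where
        arith : ∀ v q π t → v + 0 + (q + π) + t ≡ v + q + π + t
        arith = solve-∀

      all-but : ∀ {v c q′} → Split pairs (v , c) q′ → Partial ((v , c) ∷ []) (q′ ++ π st) (T st)
      all-but {v} {c} {q′} s = record
        { rows    = λ f → regroup (f v) (∑ (f ∘ proj₁) q′) (∑ (f ∘ proj₁) (π st)) (∑ (λ (_ , w , w′) → f w + f w′) (T st))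
            (∑-++ (f ∘ proj₁) q′ (π st)) (∑-split s (f ∘ proj₁)) (Partial.rows start f)
        ; columns = λ f → regroup (f c) (∑ (f ∘ proj₂) q′) (∑ (f ∘ proj₂) (π st)) (2 * ∑ (f ∘ proj₁) (T st))
            (∑-++ (f ∘ proj₂) q′ (π st)) (∑-split s (f ∘ proj₂)) (Partial.columns start f)
        }

      postpone-at : ∀ {v c q′} → Split pairs (v , c) q′ → weight q′ ≡ 0 → Reroute v c (T st) →
        length (U st) ≡ a → Postponing st
      postpone-at {v} {c} {q′} s q′-free rr |U|≡a = record
        { pending′ = record
          { partial = all-but s ; poolT = pool-idle ; row≤ = v-row s ; col≤ = c-col s ; reroute-of-v = rr }
        -- Together with the a - 1 free pairs in `q′` the edge from `v` to the reserved centre fills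
        -- the move exactly.
        ; claims   = (v , Reroute.c′ rr) ∷ q′
        ; #claims≤ = ≤-reflexive (trans (sym (Split-length s)) (trans |q|≡|U| |U|≡a))
        ; free     = Reroute.v-free rr ∷ ∑≡0⇒All (λ (u , c) → x u c) q′ q′-free
        ; awaits   = λ (π-held , _ , T-held) →
            inj₂ (here refl) , ++⁺ (All.tabulate (λ p∈ → inj₂ (there p∈))) (All.map inj₁ π-held) ,
            All.map (λ (p , q) → inj₁ p , inj₁ q) T-held
        }

      postpone : length (U st) ≡ a → weight pairs ≡ 1 → Postponing st
      postpone |U|≡a b≡1 with find-positive (λ (u , c) → x u c) pairs (≤-reflexive (sym b≡1))
      ... | (v , c) , q′ , s , 0<xvc = postpone-at s q′-free
        (find-reroute v c (T st) (enough {rowT v (T st)} {colT c (T st)} {B = a} {l = 0} (v-row s) (c-col s) (T-large (s≤s z≤n)))) |U|≡a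
        where
        q′-free : weight q′ ≡ 0
        q′-free = n≤0⇒n≡0 (≤-pred (≤-trans (+-monoˡ-≤ (weight q′) 0<xvc)
          (≤-trans (≤-reflexive (sym (∑-split s (λ (u , c) → x u c)))) (≤-reflexive b≡1))))

    endgame-with : Finishing (Held st) x a ⊎ (length (U st) ≡ a × Postponing st)
    endgame-with with few-blocked (weight pairs) (length (U st)) (≤-trans light (≤-trans (e≤Φ st) Φ≤a)) weight≤ U≤a
    ... | inj₁ m+b≤a = inj₁ (record { Finishing fin
        ; finished = λ (π-held , _ , T-held) → Finishing.finished fin (π-held , T-held) })
      where
      fin : Finishing (λ Own → All Own (π st) × Triples Own (T st)) x a
      fin = Finishing-≤ (≤-trans (≤-reflexive (cong (_+ weight pairs) |q|≡|U|)) m+b≤a)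
        (resolve a pairs (π st) (T st) start rows≤ cols≤
          (T-large (≤-trans (≤-reflexive |q|≡|U|) (≤-trans U≤a (≤-trans (m≤n*m a 2) (n≤1+n _))))))
    ... | inj₂ (|U|≡a , b≡1) = inj₂ (|U|≡a , postpone |U|≡a b≡1)

  Φ≤D : ∀ st → Φ st ≤ D st
  Φ≤D st = +-mono-≤ (+-monoʳ-≤ (e (U st) (C st)) (∑-mono (λ u → m∸n≤m _ 1) (U st))) (∑-mono (λ c → m∸n≤m _ 1) (C st))

  -- Since |C₀| > a, the own slots of `C₀` cannot all be open when at most `a` leaves remain. The
  -- middle phase may last until now, but then D < |C| ≤ a bounds `Φ` as well.
  nearly-done : ∀ st → length (U st) ≤ a → Inv a st → Idle st × Φ st ≤ a
  nearly-done st U≤a inv = conclude inv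
    where
    a<C₀ : a < length C₀
    a<C₀ = ≤-<-trans (≤-trans (m≤m+n a (κ * a)) (m≤m+n _ (2 * length P))) C₀-large
    not-full : ¬ Full st
    not-full full = <-irrefl refl (<-≤-trans a<C₀
      (≤-trans (≤-reflexive (sym (full-length st full))) (≤-trans (C≤U st) U≤a)))
    conclude : Inv a st → Idle st × Φ st ≤ a
    conclude (early _ _ full)         = contradiction full not-full
    conclude (middle _ (inj₂ full))   = contradiction full not-full
    conclude (middle lt (inj₁ idle))  = idle ,
      ≤-trans (Φ≤D st) (≤-trans (<⇒≤ (middle⇒D<C st lt ≤-refl)) (≤-trans (C≤U st) U≤a))
    conclude (late idle Φ≤a)          = idle , Φ≤a

  endgame : (∀ u c → x u c ≤ 1) → ∀ st → length (U st) ≤ a → Inv a st →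
    Finishing (Held st) x a ⊎ (length (U st) ≡ a × Postponing st)
  endgame x≤1 st U≤a inv =
    let idle , Φ≤a = nearly-done st U≤a inv
        q , light = light-matching (U st) (C st) (idle-balanced st idle)
    in endgame-with x≤1 st idle Φ≤a U≤a q light

-- The effect of a Breaker move

module Reply (S : Setup) (x y x′ : Setup.Rw S → Setup.Cl S → ℕ)
  (x′≤ : ∀ u c → x′ u c ≤ x u c + y u c)
  (few : ∑ (λ u → ∑ (y u) (Setup.C₀ S) + ∑ (y u) (Setup.P S)) (Setup.Rows S) ≤ Setup.a S) where
  open Setup S
  open Strategy S
  open State
  open Repair S
  private
    module B = Bipartite y
    module X = Position x
    module Y = Position y
    module X′ = Position x′

  -- `D` counts no leaf-centre pair twice: `U`, `H` and `T` hold disjoint parts of `Rows`, and `C`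
  -- is part of `C₀`, apart from `P`. So the at most `a` new edges contribute at most `a`.
  hits : ∀ st → Y.D st ≤ a
  hits st = begin
    B.e (U st) (C st) + B.e (U st) P + ∑ (Y.colW st) (C st)
      ≡⟨ cong₂ _+_ (sym (∑-+ (λ u → B.row u (C st)) (λ u → B.row u P) (U st))) (W-swap st) ⟩
    ∑ (λ u → B.row u (C st) + B.row u P) (U st) + W st (λ w → B.row w (C st))
      ≤⟨ +-mono-≤ (∑-mono (λ u → +-monoˡ-≤ (B.row u P) (C⊆C₀ st (y u))) (U st))
           (W-mono st (λ w → ≤-trans (C⊆C₀ st (y w)) (m≤m+n _ (B.row w P)))) ⟩
    ∑ g (U st) + W st g                                  ≤⟨ +-monoˡ-≤ (W st g) (m≤m+n (∑ g (U st)) (∑ (g ∘ proj₁) (π st))) ⟩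
    ∑ g (U st) + ∑ (g ∘ proj₁) (π st) + W st g           ≡⟨ rows st g ⟩
    ∑ g Rows                                             ≤⟨ few ⟩
    a                                                    ∎
    where
    open ≤-Reasoning
    g : Rw → ℕ
    g u = B.row u C₀ + B.row u P
    W-mono : ∀ st {f h : Rw → ℕ} → (∀ w → f w ≤ h w) → W st f ≤ W st h
    W-mono st f≤h = +-mono-≤ (∑-mono (λ _ → f≤h _) (H st)) (∑-mono (λ _ → +-mono-≤ (f≤h _) (f≤h _)) (T st))
    W-swap : ∀ st → ∑ (Y.colW st) (C st) ≡ W st (λ w → B.row w (C st))
    W-swap st = trans (∑-+ (λ c → ∑ (λ (w , _) → y w c) (H st)) (λ c → ∑ (λ (_ , w , w′) → y w c + y w′ c) (T st)) (C st))
      (cong₂ _+_ (sym (∑-swap (λ (w , _) → y w) (H st) (C st)))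
        (trans (sym (∑-swap (λ (_ , w , w′) c → y w c + y w′ c) (T st) (C st)))
          (∑-cong (λ (_ , w , w′) → ∑-+ (y w) (y w′) (C st)) (T st))))

  private
    record _≤_⊕_ (p q r : ℕ) : Set where
      constructor bound
      field unbound : p ≤ q + r

    open _≤_⊕_

    ∑-bound : ∀ {A : Set} {f g h : A → ℕ} → (∀ z → f z ≤ g z ⊕ h z) → ∀ zs → ∑ f zs ≤ ∑ g zs ⊕ ∑ h zs
    ∑-bound {g = g} {h} f≤ zs = bound (≤-trans (∑-mono (unbound ∘ f≤) zs) (≤-reflexive (∑-+ g h zs)))

    +-bound : ∀ {p q r s t v} → p ≤ q ⊕ r → s ≤ t ⊕ v → (p + s) ≤ (q + t) ⊕ (r + v)
    +-bound {q = q} {r} {t = t} {v} (bound p≤) (bound s≤) = bound (≤-trans (+-mono-≤ p≤ s≤) (≤-reflexive (arith q r t v)))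
      where
      arith : ∀ q r t v → (q + r) + (t + v) ≡ (q + t) + (r + v)
      arith = solve-∀

    ∸-bound : ∀ {p q r} → p ≤ q ⊕ r → (p ∸ 1) ≤ (q ∸ 1) ⊕ r
    ∸-bound {p} {zero}  (bound le) = bound (≤-trans (m∸n≤m p 1) le)
    ∸-bound {p} {suc q} (bound le) = bound (∸-monoˡ-≤ 1 le)

    cell-bound : ∀ u c → x′ u c ≤ x u c ⊕ y u c
    cell-bound u c = bound (x′≤ u c)

    row-bound : ∀ u cs → Bipartite.row x′ u cs ≤ Bipartite.row x u cs ⊕ B.row u cs
    row-bound u = ∑-bound (cell-bound u)

    colW-bound : ∀ st c → X′.colW st c ≤ X.colW st c ⊕ Y.colW st c
    colW-bound st c = +-bound (∑-bound (λ (w , _) → cell-bound w c) (H st))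
      (∑-bound (λ (_ , w , w′) → +-bound (cell-bound w c) (cell-bound w′ c)) (T st))

  D-bound : ∀ st → X′.D st ≤ X.D st + a
  D-bound st = ≤-trans
    (unbound (+-bound (+-bound (∑-bound (λ u → row-bound u (C st)) (U st)) (∑-bound (λ u → row-bound u P) (U st)))
             (∑-bound (colW-bound st) (C st))))
    (+-monoʳ-≤ (X.D st) (hits st))

  Φ-bound : ∀ st → X′.Φ st ≤ X.Φ st + a
  Φ-bound st = ≤-trans
    (unbound (+-bound (+-bound (∑-bound (λ u → row-bound u (C st)) (U st)) (∑-bound (λ u → ∸-bound (row-bound u P)) (U st)))
             (∑-bound (λ c → ∸-bound (colW-bound st c)) (C st))))
    (+-monoʳ-≤ (X.Φ st) (hits st))

  -- Each potential grows by at most `a`, which is just what raising `j` from 0 to `a` permits.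
  reply : ∀ st → X.Inv 0 st → X′.Inv a st
  reply st (X.early D≤0 W≡0 full) = X′.early (≤-trans (D-bound st) (+-monoˡ-≤ a D≤0)) W≡0 full
  reply st (X.late idle Φ≤0)      = X′.late idle (≤-trans (Φ-bound st) (+-monoˡ-≤ a Φ≤0))
  reply st (X.middle lt mode)     = X′.middle (by-slack 0 (+-mono-≤ lt (D-bound st))
      (arith (X.D st) (X′.D st) (length (A st) + pending st) a (length (C st)))) mode
    where
    arith : ∀ d d′ t a c → suc (d′ + t + a) + (c + 0 + (d + a) + 0) ≡ c + a + (suc (d + t + a) + d′)
    arith = solve-∀

  private
    module E = Endgame S x
    module R = Rerouting x
    module R′ = Rerouting x′

  -- For a ≥ 2 both edges of an exchange fit into one move, so an exchange is sought afresh after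
  -- Breaker's move; up to a + 1 stars were blocked before and `a` edges are new, hence B = 2 a and
  -- |P| ≥ 4 a + 3. For a = 1 the edge from `v` to `c′` is already there, and Breaker's single new
  -- edge cannot block both leaves of that star from `c`.
  finish-pending : 1 ≤ a → (∀ u c → x′ u c ≤ 1) → (p : E.Pending) → Finishing (E.Pending.Awaiting p) x′ a
  finish-pending 1≤a x′≤1 p with m≤n⇒m<n∨m≡n 1≤a
  ... | inj₁ 1<a = record { Finishing fin ; finished = λ (_ , π-owned , T-owned) → Finishing.finished fin (π-owned , T-owned) }
    where
    open E.Pending p
    g : Rw → ℕ
    g u = B.row u C₀ + B.row u P
    v≤ : ∀ f → f v ≤ ∑ f Rows
    v≤ f = ≤-trans (≤-trans (≤-trans (m≤m+n (f v) 0) (m≤m+n _ (∑ (f ∘ proj₁) π′))) (m≤m+n _ _))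
      (≤-reflexive (Partial.rows partial f))
    rowT≤ : R′.rowT v T″ ≤ suc (a + a)
    rowT≤ = ≤-trans (unbound (∑-bound (λ (c , _ , _) → cell-bound v c) T″)) (+-mono-≤ row≤
      (≤-trans (≤-reflexive (poolT (y v))) (≤-trans (m≤n+m _ (B.row v C₀)) (≤-trans (v≤ g) few))))
    colT≤ : R′.colT c T″ ≤ suc (a + a)
    colT≤ = ≤-trans (unbound (∑-bound (λ (_ , w , w′) → +-bound (cell-bound w c) (cell-bound w′ c)) T″)) (+-mono-≤ col≤
      (≤-trans (m≤n+m _ (y v c + 0 + ∑ (λ (u , _) → y u c) π′))
        (≤-trans (≤-reflexive (Partial.rows partial (λ u → y u c))) (≤-trans (∑-mono (λ u → complete (y u) c) Rows) few))))
    single : ∀ {n m} → n ≤ suc m → n ∸ 1 + 0 ≤ m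
    single le = ≤-trans (≤-reflexive (+-identityʳ _)) (∸-monoˡ-≤ 1 le)
    size : 2 * (a + a) + 2 + 1 ≤ length T″
    size = ≤-trans (≤-reflexive (arith a)) (≤-trans P-large
      (≤-reflexive (trans (sym (∑-1 P)) (trans (sym (poolT (λ _ → 1))) (∑-1 T″)))))
      where
      arith : ∀ a → 2 * (a + a) + 2 + 1 ≡ 4 * a + 3
      arith = solve-∀
    fin : Finishing (λ Own → All Own π′ × Triples Own T″) x′ a
    fin = Finishing-≤ (≤-trans (s≤s (≤-trans (≤-reflexive (+-identityʳ _)) (x′≤1 v c))) 1<a)
      (R′.resolve (a + a) ((v , c) ∷ []) π′ T″ partial (single rowT≤) (single colT≤) size)
  ... | inj₂ 1≡a = escape
    where
    open E.Pending p
    open R.Reroute reroute-of-v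
    y-sum : y w c + y w′ c ≤ 1
    y-sum = begin
      y w c + y w′ c                                                       ≤⟨ m≤m+n _ (∑ (λ (_ , w , w′) → y w c + y w′ c) T′) ⟩
      y w c + y w′ c + ∑ (λ (_ , w , w′) → y w c + y w′ c) T′              ≡⟨ ∑-split s (λ (_ , w , w′) → y w c + y w′ c) ⟨
      ∑ (λ (_ , w , w′) → y w c + y w′ c) T″                               ≤⟨ m≤n+m _ (y v c + 0 + ∑ (λ (u , _) → y u c) π′) ⟩
      y v c + 0 + ∑ (λ (u , _) → y u c) π′ + ∑ (λ (_ , w , w′) → y w c + y w′ c) T″ ≡⟨ Partial.rows partial (λ u → y u c) ⟩
      ∑ (λ u → y u c) Rows                                                 ≤⟨ ∑-mono (λ u → complete (y u) c) Rows ⟩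
      ∑ (λ u → B.row u C₀ + B.row u P) Rows                                ≤⟨ few ⟩
      a                                                                    ≡⟨ 1≡a ⟨
      1                                                                    ∎
      where open ≤-Reasoning
    via : ∀ w w′ {T₁} → Split T₁ (c′ , w , w′) T′ → Partial ((v , c) ∷ []) π′ T₁ → x w c ≡ 0 → y w c ≡ 0 →
      (∀ {Own} → Triples Own T″ → Own (w′ , c′) × Triples Own T′) → Finishing Awaiting x′ a
    via w w′ s₁ partial₁ x≡0 y≡0 keep = record
      { claims   = (w , c) ∷ []
      ; #claims≤ = 1≤a
      ; free     = n≤0⇒n≡0 (≤-trans (x′≤ w c) (≤-reflexive (cong₂ _+_ x≡0 y≡0))) ∷ []
      ; finished = λ (v-owned , π-owned , T-owned) →
          let w′-owned , T′-owned = keep T-owned in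
          complete-partial (reroute s₁ partial₁)
            (inj₁ v-owned ∷ inj₂ (here refl) ∷ inj₁ w′-owned ∷ All.map inj₁ π-owned)
            (All.map (λ (p , q) → inj₁ p , inj₁ q) T′-owned)
      }
    escape : Finishing Awaiting x′ a
    escape with y w c ≟ 0
    ... | yes y≡0 = via w w′ s partial w-free y≡0 (λ T-owned →
      let (_ , w′-owned) , T′-owned = All-split s T-owned in w′-owned , T′-owned)
    ... | no y≢0 = via w′ w here (swap-leaves s partial) w′-free
      (n≤0⇒n≡0 (≤-pred (≤-trans (+-monoˡ-≤ (y w′ c) (n≢0⇒n>0 y≢0)) y-sum)))
      (λ T-owned → let (w-owned , _) , T′-owned = All-split s T-owned in w-owned , T′-owned)

-- The game tree

∣p∪q∣≤∣p∣+∣q∣ : ∀ {n} (p q : Subset n) → ∣ p ∪ q ∣ ≤ ∣ p ∣ + ∣ q ∣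
∣p∪q∣≤∣p∣+∣q∣ []            []            = z≤n
∣p∪q∣≤∣p∣+∣q∣ (inside ∷ p)  (inside ∷ q)  = s≤s (≤-trans (∣p∪q∣≤∣p∣+∣q∣ p q) (+-monoʳ-≤ ∣ p ∣ (n≤1+n _)))
∣p∪q∣≤∣p∣+∣q∣ (inside ∷ p)  (outside ∷ q) = s≤s (∣p∪q∣≤∣p∣+∣q∣ p q)
∣p∪q∣≤∣p∣+∣q∣ (outside ∷ p) (inside ∷ q)  = ≤-trans (s≤s (∣p∪q∣≤∣p∣+∣q∣ p q)) (≤-reflexive (sym (+-suc ∣ p ∣ ∣ q ∣)))
∣p∪q∣≤∣p∣+∣q∣ (outside ∷ p) (outside ∷ q) = ∣p∪q∣≤∣p∣+∣q∣ p q

fromList : ∀ {n} → List (Fin n) → Subset n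
fromList []       = ⊥
fromList (x ∷ xs) = ⁅ x ⁆ ∪ fromList xs

∣fromList∣≤ : ∀ {n} (xs : List (Fin n)) → ∣ fromList xs ∣ ≤ length xs
∣fromList∣≤ {n} []  = ≤-reflexive (∣⊥∣≡0 n)
∣fromList∣≤ (x ∷ xs) = ≤-trans (∣p∪q∣≤∣p∣+∣q∣ ⁅ x ⁆ (fromList xs)) (+-mono-≤ (≤-reflexive (∣⁅x⁆∣≡1 x)) (∣fromList∣≤ xs))

∈-fromList : ∀ {n} {x : Fin n} {xs} → x ∈ˡ xs → x ∈ fromList xs
∈-fromList {x = x} (here refl) = x∈p∪q⁺ (inj₁ (x∈⁅x⁆ x))
∈-fromList (there x∈)          = x∈p∪q⁺ (inj₂ (∈-fromList x∈))

-- Serves to pad intended claims to a legal move, whose size is prescribed.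
between : ∀ {n} (p q : Subset n) t → p ⊆ q → ∣ p ∣ ≤ t → t ≤ ∣ q ∣ → ∃[ s ] p ⊆ s × s ⊆ q × ∣ s ∣ ≡ t
between []            []            zero    _   _        _        = [] , ⊆-refl , ⊆-refl , refl
between (inside ∷ p)  (outside ∷ q) t       p⊆q _        _        = case p⊆q Vec.here of λ ()
between (inside ∷ p)  (inside ∷ q)  (suc t) p⊆q (s≤s p≤) (s≤s ≤q) =
  let s , p⊆s , s⊆q , eq = between p q t (drop-∷-⊆ p⊆q) p≤ ≤q
  in inside ∷ s , in⊆in p⊆s , in⊆in s⊆q , cong suc eq
between (outside ∷ p) (outside ∷ q) t       p⊆q p≤       ≤q       =
  let s , p⊆s , s⊆q , eq = between p q t (drop-∷-⊆ p⊆q) p≤ ≤q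
  in outside ∷ s , out⊆ p⊆s , out⊆ s⊆q , eq
between (outside ∷ p) (inside ∷ q)  t       p⊆q p≤       ≤q       with t ≤? ∣ q ∣
... | yes t≤q =
  let s , p⊆s , s⊆q , eq = between p q t (drop-∷-⊆ p⊆q) p≤ t≤q
  in outside ∷ s , out⊆ p⊆s , out⊆ s⊆q , eq
... | no t≰q =
  let s , p⊆s , s⊆q , eq = between p q ∣ q ∣ (drop-∷-⊆ p⊆q) (p⊆q⇒∣p∣≤∣q∣ (drop-∷-⊆ p⊆q)) ≤-refl
  in inside ∷ s , out⊆ p⊆s , in⊆in s⊆q , trans (cong suc eq) (≤-antisym (≰⇒> t≰q) ≤q)

allSubset? : ∀ {n} {P : Subset n → Set} → (∀ s → Dec (P s)) → Dec (∀ s → P s)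
allSubset? P? with anySubset? (λ s → ¬? (P? s))
... | yes (s , ¬Ps) = no λ all → ¬Ps (all s)
... | no ¬∃         = yes λ s → decidable-stable (P? s) (λ ¬Ps → ¬∃ (s , ¬Ps))

module GameTree {m : ℕ} (a : ℕ) (𝓕 : Subset m → Set) where
  open MakerBreaker a 𝓕

  legal-extension : ∀ c p → p ⊆ ∁ c → ∣ p ∣ ≤ a → ∃[ s ] Legal c s × p ⊆ s
  legal-extension c p p⊆ p≤a =
    let s , p⊆s , s⊆ , eq = between p (∁ c) (a ⊓ ∣ ∁ c ∣) p⊆ (⊓-glb p≤a (p⊆q⇒∣p∣≤∣q∣ p⊆)) (m⊓n≤n a _)
    in s , (s⊆ , eq) , p⊆s

  some-legal : ∀ c → ∃[ s ] Legal c s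
  some-legal c =
    let s , legal , _ = legal-extension c ⊥ (λ x∈ → contradiction x∈ ∉⊥) (≤-trans (≤-reflexive (∣⊥∣≡0 m)) z≤n)
    in s , legal

  -- Maker may aim at edges she already owns; the spare steps go to arbitrary edges.
  claim-all : ∀ h b (es : List (Fin m)) → length es ≤ a → (∀ {e} → e ∈ˡ es → e ∉ b ∪ breakerClaims h) →
    ∃[ s ] Legal (claimed h ∪ b) s × (∀ {e} → e ∈ˡ es → e ∈ s ∪ makerClaims h)
  claim-all h b es es≤a free =
    let s , legal , ⊆s = legal-extension c (fromList es ∩ ∁ c) (p∩q⊆q (fromList es) (∁ c))
          (≤-trans (∣p∩q∣≤∣p∣ (fromList es) (∁ c)) (≤-trans (∣fromList∣≤ es) es≤a))
    in s , legal , λ {e} e∈ → case e ∈? makerClaims h of λ where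
      (yes e∈M) → x∈p∪q⁺ (inj₂ e∈M)
      (no e∉M)  → x∈p∪q⁺ (inj₁ (⊆s (x∈p∩q⁺ (∈-fromList e∈ , x∉p⇒x∈∁p (unclaimed (free e∈) e∉M)))))
    where
    c : Subset m
    c = claimed h ∪ b
    unclaimed : ∀ {e} → e ∉ b ∪ breakerClaims h → e ∉ makerClaims h → e ∉ c
    unclaimed e∉ e∉M e∈c with x∈p∪q⁻ (claimed h) b e∈c
    ... | inj₂ e∈b = e∉ (x∈p∪q⁺ (inj₁ e∈b))
    ... | inj₁ e∈h with x∈p∪q⁻ (breakerClaims h) (makerClaims h) e∈h
    ... | inj₁ e∈B = e∉ (x∈p∪q⁺ (inj₂ e∈B))
    ... | inj₂ e∈M = e∉M e∈M

  -- In a proof of `Win` by induction on the number of moves, Maker's plan can be carried as an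
  -- argument, whereas a `MakerStrategy` sees only the history.
  Win : ℕ → History → Set
  Win zero    h = MakerHasWon h
  Win (suc t) h = MakerHasWon h ⊎
    (∀ b → Legal (claimed h) b → ∃[ s ] Legal (claimed h ∪ b) s × Win t ((b , s) ∷ h))

  won⇒Win : ∀ t {h} → MakerHasWon h → Win t h
  won⇒Win zero    won = won
  won⇒Win (suc t) won = inj₁ won

  module Decision (won? : ∀ h → Dec (MakerHasWon h)) where

    legal? : ∀ c s → Dec (Legal c s)
    legal? c s = (s ⊆? ∁ c) ×-dec (∣ s ∣ ≟ a ⊓ ∣ ∁ c ∣)

    win? : ∀ t h → Dec (Win t h)
    good-answer? : ∀ t h b → Dec (∃[ s ] Legal (claimed h ∪ b) s × Win t ((b , s) ∷ h))
    win? zero    h = won? h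
    win? (suc t) h = won? h ⊎-dec allSubset? (λ b → legal? (claimed h) b →-dec good-answer? t h b)
    good-answer? t h b = anySubset? (λ s → legal? (claimed h ∪ b) s ×-dec win? t ((b , s) ∷ h))

    bad-opening? : ∀ t h → Dec (∃[ b ] Legal (claimed h) b × ¬ (∃[ s ] Legal (claimed h ∪ b) s × Win t ((b , s) ∷ h)))
    bad-opening? t h = anySubset? (λ b → legal? (claimed h) b ×-dec ¬? (good-answer? t h b))

    length-play : ∀ μ β i → length (play μ β i) ≡ i
    length-play μ β zero    = refl
    length-play μ β (suc i) = cong suc (length-play μ β i)

    module _ (t : ℕ) where

      -- A strategy has no clock, so the number of moves left is read off the history.
      rest : History → ℕ
      rest h = t ∸ suc (length h)

      μ* : MakerStrategy
      μ* h b with good-answer? (rest h) h b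
      ... | yes (s , legal , _) = s , legal
      ... | no _                = some-legal (claimed h ∪ b)

      μ*-good : ∀ h b → (∃[ s ] Legal (claimed h ∪ b) s × Win (rest h) ((b , s) ∷ h)) →
        Win (rest h) ((b , proj₁ (μ* h b)) ∷ h)
      μ*-good h b good with good-answer? (rest h) h b
      ... | yes (_ , _ , win) = win
      ... | no ¬good          = contradiction good ¬good

      β* : BreakerStrategy
      β* h with bad-opening? (rest h) h
      ... | yes (b , legal , _) = b , legal
      ... | no _                = some-legal (claimed h)

      β*-good : ∀ h → ¬ Win (suc (rest h)) h → ∀ s → Legal (claimed h ∪ proj₁ (β* h)) s →
        ¬ Win (rest h) ((proj₁ (β* h) , s) ∷ h)
      β*-good h ¬win s legal win with bad-opening? (rest h) h
      ... | yes (_ , _ , ¬good) = ¬good (s , legal , win)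
      ... | no ¬bad = ¬win (inj₂ λ b b-legal →
        decidable-stable (good-answer? (rest h) h b) (λ ¬good → ¬bad (b , b-legal , ¬good)))

      private
        rest-play : ∀ μ β i → i < t → t ∸ i ≡ suc (rest (play μ β i))
        rest-play μ β i i<t = trans (+-∸-assoc 1 i<t) (cong (λ l → suc (t ∸ suc l)) (sym (length-play μ β i)))

        rest≡ : ∀ μ β i → t ∸ suc i ≡ rest (play μ β i)
        rest≡ μ β i = cong (λ l → t ∸ suc l) (sym (length-play μ β i))

      Win⇒MakerWinsWithin : Win t [] → MakerWinsWithin t
      Win⇒MakerWinsWithin win = μ* , λ β → outcome β (track β t ≤-refl)
        where
        outcome : ∀ β → (∃[ s ] s ≤ t × MakerHasWon (play μ* β s)) ⊎ Win (t ∸ t) (play μ* β t) →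
          ∃[ s ] s ≤ t × MakerHasWon (play μ* β s)
        outcome β (inj₁ won) = won
        outcome β (inj₂ win) = t , ≤-refl , subst (λ r → Win r (play μ* β t)) (n∸n≡0 t) win
        track : ∀ β i → i ≤ t → (∃[ s ] s ≤ t × MakerHasWon (play μ* β s)) ⊎ Win (t ∸ i) (play μ* β i)
        track β zero    _   = inj₂ win
        track β (suc i) i<t with track β i (<⇒≤ i<t)
        ... | inj₁ won = inj₁ won
        ... | inj₂ winᵢ with subst (λ r → Win r (play μ* β i)) (rest-play μ* β i i<t) winᵢ
        ... | inj₁ won = inj₁ (i , <⇒≤ i<t , won)
        ... | inj₂ good = inj₂ (subst (λ r → Win r (play μ* β (suc i))) (sym (rest≡ μ* β i))
          (μ*-good (play μ* β i) _ (good _ (proj₂ (β (play μ* β i))))))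

      -- Determinacy of a finite game: where `Win` fails, `β*` finds an opening after which it fails
      -- again for every answer, so no strategy wins against `β*` within `t` moves.
      MakerWinsWithin⇒Win : MakerWinsWithin t → Win t []
      MakerWinsWithin⇒Win (μ , wins) = decidable-stable (win? t []) λ ¬win →
        let s , s≤t , won = wins β* in avoid ¬win s s≤t (won⇒Win (t ∸ s) won)
        where
        avoid : ¬ Win t [] → ∀ i → i ≤ t → ¬ Win (t ∸ i) (play μ β* i)
        avoid ¬win zero    _   = ¬win
        avoid ¬win (suc i) i<t win = β*-good (play μ β* i)
          (λ winᵢ → avoid ¬win i (<⇒≤ i<t) (subst (λ r → Win r (play μ β* i)) (sym (rest-play μ β* i i<t)) winᵢ))
          _ (proj₂ (μ (play μ β* i) _))
          (subst (λ r → Win r (play μ β* (suc i))) (rest≡ μ β* i) win)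

    -- A minimum exists because `MakerWinsWithin i` can be decided through `Win i []`, so the search
    -- may start from 0.
    least-time : ∀ T → MakerWinsWithin T → ∃[ τ ] IsTau τ × τ ≤ T
    least-time T wins = search 0 T (λ s s<0 → contradiction s<0 λ ()) refl
      where
      search : ∀ i d → (∀ s → s < i → ¬ MakerWinsWithin s) → i + d ≡ T → ∃[ τ ] IsTau τ × τ ≤ T
      search i zero    none eq = T , (wins , minimal) , ≤-refl
        where
        minimal : ∀ s → MakerWinsWithin s → T ≤ s
        minimal s w = ≮⇒≥ λ s<T → none s (subst (s <_) (trans (sym eq) (+-identityʳ i)) s<T) w
      search i (suc d) none eq with win? i []
      ... | yes win = i , (Win⇒MakerWinsWithin i win , λ s w → ≮⇒≥ λ s<i → none s s<i w) ,
                      ≤-trans (m≤m+n i (suc d)) (≤-reflexive eq)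
      ... | no ¬win = search (suc i) d none′ (trans (sym (+-suc i d)) eq)
        where
        none′ : ∀ s → s < suc i → ¬ MakerWinsWithin s
        none′ s s<1+i w with m≤n⇒m<n∨m≡n (≤-pred s<1+i)
        ... | inj₁ s<i  = none s s<i w
        ... | inj₂ refl = ¬win (MakerWinsWithin⇒Win i w)

-- Star factors

Searchable : Set → Set₁
Searchable A = ∀ {P : A → Set} → (∀ x → Dec (P x)) → Dec (∃[ x ] P x)

any-pair? : ∀ {A B} → Searchable A → Searchable B → Searchable (A × B)
any-pair? search-A search-B P? =
  map′ (λ (x , y , p) → (x , y) , p) (λ ((x , y) , p) → x , y , p) (search-A λ x → search-B λ y → P? (x , y))

anyVec? : ∀ {A} → Searchable A → ∀ n → Searchable (Vec A n)
anyVec? search zero    P? = map′ ([] ,_) (λ { ([] , p) → p }) (P? [])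
anyVec? search (suc n) P? =
  map′ (λ (x , xs , p) → x ∷ xs , p) (λ { (x ∷ xs , p) → x , xs , p }) (search λ x → anyVec? search n λ xs → P? (x ∷ xs))

module _ {n : ℕ} where

  vertexSet : Fin n × Subset n → Subset n
  vertexSet (c , L) = ⁅ c ⁆ ∪ L

  Joins : Fin n × Subset n → Fin n × Fin n → Set
  Joins (c , L) (u , v) = (u ≡ c × v ∈ L) ⊎ (v ≡ c × u ∈ L)

  joins? : ∀ z uv → Dec (Joins z uv)
  joins? (c , L) (u , v) = ((u ≟ᶠ c) ×-dec (v ∈? L)) ⊎-dec ((v ≟ᶠ c) ×-dec (u ∈? L))

  module _ {k : ℕ} (s : Star k n) (e : Fin (Board n)) where

    HasEdge⇒Joins : Star.HasEdge s e → Joins (Star.centre s , Star.leaves s) (lookup (edges n) e)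
    HasEdge⇒Joins h with lookup (edges n) e
    ... | u , v = h

    Joins⇒HasEdge : Joins (Star.centre s , Star.leaves s) (lookup (edges n) e) → Star.HasEdge s e
    Joins⇒HasEdge h with lookup (edges n) e
    ... | u , v = h

module _ {k n : ℕ} .{{_ : NonZero k}} where

  hasEdge? : (P : StarFactor k n) → ∀ e → Dec (StarFactor.HasEdge P e)
  hasEdge? P e = any? λ i →
    map′ (Joins⇒HasEdge (StarFactor.star P i) e) (HasEdge⇒Joins (StarFactor.star P i) e) (joins? _ _)

  edgeSet : StarFactor k n → Subset (Board n)
  edgeSet P = Vec.tabulate (λ e → does (hasEdge? P e))

  edgeSet-correct : ∀ P e → e ∈ edgeSet P ⇔ StarFactor.HasEdge P e
  edgeSet-correct P e = mk⇔ to from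
    where
    eq : Vec.lookup (edgeSet P) e ≡ does (hasEdge? P e)
    eq = lookup∘tabulate (λ e → does (hasEdge? P e)) e
    to : e ∈ edgeSet P → StarFactor.HasEdge P e
    to e∈ with hasEdge? P e | trans (sym eq) ([]=⇒lookup e∈)
    ... | yes h | _ = h
    ... | no _  | ()
    from : StarFactor.HasEdge P e → e ∈ edgeSet P
    from h = lookup⇒[]= e (edgeSet P) (trans eq (dec-true (hasEdge? P e) h))

  factor-in : ∀ {M} (P : StarFactor k n) → (∀ e → StarFactor.HasEdge P e → e ∈ M) → ∃[ F ] 𝓢 k n F × F ⊆ M
  factor-in P within = edgeSet P , (P , edgeSet-correct P) , λ e∈ → within _ (Equivalence.to (edgeSet-correct P _) e∈)

  -- A star factor inside `M` as raw data with its conditions stated apart, so that finitely many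
  -- candidates can be searched.
  IsFactorIn : Subset (Board n) → (Fin (n / k) → Fin n × Subset n) → Set
  IsFactorIn M z =
      (∀ i → (proj₁ (z i) ∉ proj₂ (z i)) × (suc ∣ proj₂ (z i) ∣ ≡ k))
    × (∀ i j → i ≢ j → Empty (vertexSet (z i) ∩ vertexSet (z j)))
    × (∀ v → ∃[ i ] v ∈ vertexSet (z i))
    × (∀ e i → Joins (z i) (lookup (edges n) e) → e ∈ M)

  isFactorIn? : ∀ M z → Dec (IsFactorIn M z)
  isFactorIn? M z =
          all? (λ i → ¬? (proj₁ (z i) ∈? proj₂ (z i)) ×-dec (suc ∣ proj₂ (z i) ∣ ≟ k))
    ×-dec all? (λ i → all? λ j → ¬? (i ≟ᶠ j) →-dec ¬? (nonempty? (vertexSet (z i) ∩ vertexSet (z j))))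
    ×-dec all? (λ v → any? λ i → v ∈? vertexSet (z i))
    ×-dec all? (λ e → all? λ i → joins? (z i) (lookup (edges n) e) →-dec (e ∈? M))

  IsFactorIn-cong : ∀ {M z z′} → (∀ i → z i ≡ z′ i) → IsFactorIn M z → IsFactorIn M z′
  IsFactorIn-cong {M} {z} {z′} z≗ (stars , disjoint , covering , within) =
      (λ i → subst (λ y → (proj₁ y ∉ proj₂ y) × (suc ∣ proj₂ y ∣ ≡ k)) (z≗ i) (stars i))
    , (λ i j i≢j → subst (λ y → Empty (vertexSet (z′ i) ∩ vertexSet y)) (z≗ j)
        (subst (λ y → Empty (vertexSet y ∩ vertexSet (z j))) (z≗ i) (disjoint i j i≢j)))
    , (λ v → let i , v∈ = covering v in i , subst (λ y → v ∈ vertexSet y) (z≗ i) v∈)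
    , (λ e i joins → within e i (subst (λ y → Joins y (lookup (edges n) e)) (sym (z≗ i)) joins))

  factor-in? : ∀ M → Dec (∃[ F ] 𝓢 k n F × F ⊆ M)
  factor-in? M = map′ to from
    (anyVec? (any-pair? any? anySubset?) (n / k) (λ zs → isFactorIn? M (Vec.lookup zs)))
    where
    to : (∃[ zs ] IsFactorIn M (Vec.lookup zs)) → ∃[ F ] 𝓢 k n F × F ⊆ M
    to (zs , stars , disjoint , covering , within) = factor-in P λ e (i , h) →
      within e i (HasEdge⇒Joins (StarFactor.star P i) e h)
      where
      P : StarFactor k n
      P = record
        { star = λ i → record
          { centre = proj₁ (Vec.lookup zs i) ; leaves = proj₂ (Vec.lookup zs i)
          ; centre∉ = proj₁ (stars i) ; size = proj₂ (stars i) }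
        ; disjoint = λ i≢j → disjoint _ _ i≢j
        ; covering = covering
        }
    from : (∃[ F ] 𝓢 k n F × F ⊆ M) → ∃[ zs ] IsFactorIn M (Vec.lookup zs)
    from (F , (P , iff) , F⊆M) = Vec.tabulate z , IsFactorIn-cong (λ i → sym (lookup∘tabulate z i))
        ( (λ i → Star.centre∉ (star i) , Star.size (star i))
        , (λ i j i≢j → disjoint i≢j)
        , covering
        , λ e i joins → F⊆M (Equivalence.from (iff e) (i , Joins⇒HasEdge (star i) e joins)))
      where
      open StarFactor P
      z : Fin (n / k) → Fin n × Subset n
      z i = Star.centre (star i) , Star.leaves (star i)

-- Indicator functions and counting of edges

bit : Bool → ℕ
bit true  = 1
bit false = 0

bit≤1 : ∀ b → bit b ≤ 1
bit≤1 true  = ≤-refl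
bit≤1 false = z≤n

χ : ∀ {n} → Subset n → Fin n → ℕ
χ s e = bit (Vec.lookup s e)

χ≡0⇒∉ : ∀ {n} {s : Subset n} {e} → χ s e ≡ 0 → e ∉ s
χ≡0⇒∉ eq e∈ with trans (sym (cong bit ([]=⇒lookup e∈))) eq
... | ()

χ-⊥ : ∀ {n} (e : Fin n) → χ ⊥ e ≡ 0
χ-⊥ e = cong bit (lookup-replicate e outside)

χ-∪ : ∀ {n} (s t : Subset n) e → χ (s ∪ t) e ≤ χ t e + χ s e
χ-∪ s t e rewrite lookup-zipWith _∨_ e s t with Vec.lookup s e | Vec.lookup t e
... | true  | true  = s≤s z≤n
... | true  | false = ≤-refl
... | false | true  = ≤-refl
... | false | false = ≤-refl

lookup-injective : ∀ {A : Set} {xs : List A} → Unique xs → ∀ i j → lookup xs i ≡ lookup xs j → i ≡ j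
lookup-injective (x∉ ∷ u) zero    zero    eq = refl
lookup-injective (x∉ ∷ u) zero    (suc j) eq = contradiction eq (All.lookup x∉ (∈-lookup j))
lookup-injective (x∉ ∷ u) (suc i) zero    eq = contradiction (sym eq) (All.lookup x∉ (∈-lookup i))
lookup-injective (x∉ ∷ u) (suc i) (suc j) eq = cong suc (lookup-injective u i j eq)

-- Each entry met in `s` is deleted from `s`; being distinct from it, the later entries keep their
-- indicators.
∑-χ≤ : ∀ {n} {es : List (Fin n)} → Unique es → ∀ s → ∑ (χ s) es ≤ ∣ s ∣
∑-χ≤ []                             s = z≤n
∑-χ≤ {es = e ∷ es} (e∉ ∷ u) s with Vec.lookup s e in eq
... | false = ∑-χ≤ u s
... | true  = ≤-trans (s≤s (≤-trans (shrink es e∉) (∑-χ≤ u (s - e)))) (x∈p⇒∣p-x∣<∣p∣ (lookup⇒[]= e s eq))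
  where
  shrink : ∀ fs → All (e ≢_) fs → ∑ (χ s) fs ≤ ∑ (χ (s - e)) fs
  shrink []       []            = z≤n
  shrink (f ∷ fs) (e≢f ∷ e≢fs) = +-mono-≤ cell (shrink fs e≢fs)
    where
    cell : χ s f ≤ χ (s - e) f
    cell with Vec.lookup s f in eq′
    ... | false = z≤n
    ... | true  = ≤-reflexive (sym (cong bit ([]=⇒lookup (x∈p∧x≢y⇒x∈p-y (lookup⇒[]= f s eq′) (e≢f ∘ sym)))))

∑-cartesianProduct : ∀ {A B : Set} (f : A → B → ℕ) xs ys →
  ∑ (uncurry f) (cartesianProduct xs ys) ≡ ∑ (λ x → ∑ (f x) ys) xs
∑-cartesianProduct f []       ys = refl
∑-cartesianProduct f (x ∷ xs) ys = trans (∑-++ (uncurry f) (map (x ,_) ys) _)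
  (cong₂ _+_ (∑-map-pair ys) (∑-cartesianProduct f xs ys))
  where
  ∑-map-pair : ∀ ys → ∑ (uncurry f) (map (x ,_) ys) ≡ ∑ (f x) ys
  ∑-map-pair []       = refl
  ∑-map-pair (y ∷ ys) = cong (f x y +_) (∑-map-pair ys)

∑-map : ∀ {A B : Set} (f : B → ℕ) (g : A → B) xs → ∑ f (map g xs) ≡ ∑ (f ∘ g) xs
∑-map f g []       = refl
∑-map f g (x ∷ xs) = cong (f (g x) +_) (∑-map f g xs)

∑-indicator : ∀ {n} {A : Set} (g : Fin n → A) (f : A → ℕ) i → f (g i) ≡ 1 → (∀ j → j ≢ i → f (g j) ≡ 0) →
  ∑ f (List.tabulate g) ≡ 1
∑-indicator g f zero    one zeros = trans (cong₂ _+_ one (vanish (g ∘ suc) (λ j → zeros (suc j) λ ()))) refl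
  where
  vanish : ∀ {n} (h : Fin n → _) → (∀ j → f (h j) ≡ 0) → ∑ f (List.tabulate h) ≡ 0
  vanish {zero}  h _ = refl
  vanish {suc n} h v = cong₂ _+_ (v zero) (vanish (h ∘ suc) (v ∘ suc))
∑-indicator g f (suc i) one zeros =
  cong₂ _+_ (zeros zero λ ()) (∑-indicator (g ∘ suc) f i one λ j j≢i → zeros (suc j) λ { refl → j≢i refl })

δ : ∀ {n} → Fin n → Fin n → ℕ
δ i j = bit (does (j ≟ᶠ i))

δ-refl : ∀ {n} (i : Fin n) → δ i i ≡ 1
δ-refl i with i ≟ᶠ i
... | yes _  = refl
... | no i≢i = contradiction refl i≢i

δ>0⇒≡ : ∀ {n} {i j : Fin n} → 0 < δ i j → j ≡ i
δ>0⇒≡ {i = i} {j} 0<δ with j ≟ᶠ i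
... | yes eq = eq

∑-δ : ∀ {n} (i : Fin n) → ∑ (δ i) (allFin n) ≡ 1
∑-δ i = ∑-indicator id (δ i) i (δ-refl i) off
  where
  off : ∀ j → j ≢ i → δ i j ≡ 0
  off j j≢i with j ≟ᶠ i
  ... | yes eq = contradiction eq j≢i
  ... | no _   = refl

∣tabulate∣ : ∀ {n} {A : Set} (g : Fin n → A) (b : A → Bool) → ∣ Vec.tabulate (b ∘ g) ∣ ≡ ∑ (bit ∘ b) (List.tabulate g)
∣tabulate∣ {zero}  g b = refl
∣tabulate∣ {suc n} g b with b (g zero)
... | true  = cong suc (∣tabulate∣ (g ∘ suc) b)
... | false = ∣tabulate∣ (g ∘ suc) b

module _ {A : Set} where

  ∈⇒Split : ∀ {x : A} {xs} → x ∈ˡ xs → ∃[ ys ] Split xs x ys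
  ∈⇒Split (here refl) = _ , here
  ∈⇒Split (there x∈)  = let ys , s = ∈⇒Split x∈ in _ , there s

  Split⇒∈ : ∀ {x : A} {xs ys} → Split xs x ys → x ∈ˡ xs
  Split⇒∈ here      = here refl
  Split⇒∈ (there s) = there (Split⇒∈ s)

  ∑-cong-∈ : ∀ {f g : A → ℕ} xs → (∀ {x} → x ∈ˡ xs → f x ≡ g x) → ∑ f xs ≡ ∑ g xs
  ∑-cong-∈ []       f≗g = refl
  ∑-cong-∈ (x ∷ xs) f≗g = cong₂ _+_ (f≗g (here refl)) (∑-cong-∈ xs (f≗g ∘ there))

  ∑≤1⇒unique : ∀ (f : A → ℕ) {x y xs} → ∑ f xs ≤ 1 → x ∈ˡ xs → y ∈ˡ xs → 0 < f x → 0 < f y → x ≡ y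
  ∑≤1⇒unique f ∑≤1 (here refl) (here refl) _ _ = refl
  ∑≤1⇒unique f {xs = z ∷ zs} ∑≤1 (here refl) (there y∈) 0<x 0<y = contradiction (≤-trans (+-mono-≤ 0<x (≤-trans 0<y
    (≤-trans (m≤m+n _ _) (≤-reflexive (sym (∑-split (proj₂ (∈⇒Split y∈)) f)))))) ∑≤1) λ { (s≤s ()) }
  ∑≤1⇒unique f {xs = z ∷ zs} ∑≤1 (there x∈) (here refl) 0<x 0<y = contradiction (≤-trans (+-mono-≤ 0<y (≤-trans 0<x
    (≤-trans (m≤m+n _ _) (≤-reflexive (sym (∑-split (proj₂ (∈⇒Split x∈)) f)))))) ∑≤1) λ { (s≤s ()) }
  ∑≤1⇒unique f {xs = z ∷ zs} ∑≤1 (there x∈) (there y∈) 0<x 0<y =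
    ∑≤1⇒unique f (≤-trans (m≤n+m _ (f z)) ∑≤1) x∈ y∈ 0<x 0<y

-- From leaf-centre pairs to star factors

module Layout {p N n : ℕ} where

  cen : p + N ≡ n → Fin p → Fin n
  cen refl i = i ↑ˡ N

  leaf : p + N ≡ n → Fin N → Fin n
  leaf refl u = p ↑ʳ u

  -- `edges` lists every edge with its smaller end first; with centres numbered before leaves, this
  -- end is the centre.
  cen<leaf : ∀ eq i u → cen eq i <ᶠ leaf eq u
  cen<leaf refl i u = ≤-trans (s≤s (≤-reflexive (toℕ-↑ˡ i N)))
    (≤-trans (toℕ<n i) (≤-trans (m≤m+n p (toℕ u)) (≤-reflexive (sym (toℕ-↑ʳ p u)))))

  cen-injective : ∀ eq {i j} → cen eq i ≡ cen eq j → i ≡ j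
  cen-injective refl = ↑ˡ-injective N _ _

  leaf-injective : ∀ eq {i j} → leaf eq i ≡ leaf eq j → i ≡ j
  leaf-injective refl = ↑ʳ-injective p _ _

  classify : ∀ eq v → (∃[ i ] v ≡ cen eq i) ⊎ (∃[ u ] v ≡ leaf eq u)
  classify refl v with splitAt p v | join-splitAt p N v
  ... | inj₁ i | eq = inj₁ (i , sym eq)
  ... | inj₂ u | eq = inj₂ (u , sym eq)

  leafSet : p + N ≡ n → Subset N → Subset n
  leafSet refl s = ⊥ {p} Vec.++ s

  ∣leafSet∣ : ∀ eq s → ∣ leafSet eq s ∣ ≡ ∣ s ∣
  ∣leafSet∣ refl s = pad p s
    where
    pad : ∀ p {N} (s : Subset N) → ∣ ⊥ {p} Vec.++ s ∣ ≡ ∣ s ∣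
    pad zero    s = refl
    pad (suc p) s = pad p s

  leaf∈leafSet : ∀ eq {s u} → u ∈ s → leaf eq u ∈ leafSet eq s
  leaf∈leafSet refl {s} {u} u∈ = lookup⇒[]= (p ↑ʳ u) (⊥ {p} Vec.++ s) (trans (lookup-++ʳ (⊥ {p}) s u) ([]=⇒lookup u∈))

  leafSet-leaf : ∀ eq {s u} → leaf eq u ∈ leafSet eq s → u ∈ s
  leafSet-leaf refl {s} {u} u∈ = lookup⇒[]= u s (trans (sym (lookup-++ʳ (⊥ {p}) s u)) ([]=⇒lookup u∈))

  cen∉leafSet : ∀ eq {s i} → cen eq i ∉ leafSet eq s
  cen∉leafSet refl {s} {i} c∈ = ∉⊥ (lookup⇒[]= i ⊥ (trans (sym (lookup-++ˡ (⊥ {p}) s i)) ([]=⇒lookup c∈)))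

module Assignment {k n : ℕ} .{{_ : NonZero k}} (k≥1 : 1 ≤ k) {N : ℕ} (n≡ : n / k + N ≡ n) where
  open Layout {n / k} {N} {n}

  p : ℕ
  p = n / k

  private
    edge∈ : ∀ u i → (cen n≡ i , leaf n≡ u) ∈ˡ edges n
    edge∈ u i = ∈-filter⁺ (λ (u , v) → u <ᶠ? v) (∈-cartesianProduct⁺ (∈-allFin _) (∈-allFin _)) (cen<leaf n≡ i u)

    edges-unique : Unique (edges n)
    edges-unique = filter⁺ (λ (u , v) → u <ᶠ? v) (cartesianProduct-unique (allFin⁺ n) (allFin⁺ n))

  edge : Fin N → Fin p → Fin (Board n)
  edge u i = Any.index (edge∈ u i)

  lookup-edge : ∀ u i → lookup (edges n) (edge u i) ≡ (cen n≡ i , leaf n≡ u)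
  lookup-edge u i = sym (lookup-index (edge∈ u i))

  edge-injective : ∀ {u i v j} → edge u i ≡ edge v j → u ≡ v × i ≡ j
  edge-injective {u} {i} {v} {j} eq =
    leaf-injective n≡ (,-injectiveʳ pairs≡) , cen-injective n≡ (,-injectiveˡ pairs≡)
    where
    pairs≡ : (cen n≡ i , leaf n≡ u) ≡ (cen n≡ j , leaf n≡ v)
    pairs≡ = trans (sym (lookup-edge u i)) (trans (cong (lookup (edges n)) eq) (lookup-edge v j))

  ∑-χ-edges≤ : ∀ s → ∑ (λ u → ∑ (λ i → χ s (edge u i)) (allFin p)) (allFin N) ≤ ∣ s ∣
  ∑-χ-edges≤ s = begin
    ∑ (λ u → ∑ (λ i → χ s (edge u i)) (allFin p)) (allFin N)     ≡⟨ ∑-cartesianProduct (λ u i → χ s (edge u i)) (allFin N) (allFin p) ⟨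
    ∑ (χ s ∘ uncurry edge) (cartesianProduct (allFin N) (allFin p))  ≡⟨ ∑-map (χ s) (uncurry edge) (cartesianProduct (allFin N) (allFin p)) ⟨
    ∑ (χ s) (map (uncurry edge) (cartesianProduct (allFin N) (allFin p)))
      ≤⟨ ∑-χ≤ (map⁺ (λ eq → let u≡ , i≡ = edge-injective eq in cong₂ _,_ u≡ i≡) (cartesianProduct-unique (allFin⁺ N) (allFin⁺ p))) s ⟩
    ∣ s ∣ ∎
    where open ≤-Reasoning

  module _ (M : Subset (Board n)) (X : List (Fin N × Fin p))
    (rows : ∀ f → ∑ (f ∘ proj₁) X ≡ ∑ f (allFin N))
    (columns : ∀ f → ∑ (f ∘ proj₂) X ≡ (k ∸ 1) * ∑ f (allFin p))
    (owned : All (λ (u , i) → edge u i ∈ M) X) where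

    private
      -- The sum identities are evaluated at indicators: `rows (δ u)` says that `u` occurs exactly
      -- once in `X`, and `columns (δ i)` that `i` occurs k - 1 times.
      find : ∀ u → ∃[ i ] (u , i) ∈ˡ X
      find u with find-positive (δ u ∘ proj₁) X (≤-reflexive (sym (trans (rows (δ u)) (∑-δ u))))
      ... | (v , i) , _ , s , 0<δ = i , subst (λ w → (w , i) ∈ˡ X) (δ>0⇒≡ 0<δ) (Split⇒∈ s)

      centre-of : Fin N → Fin p
      centre-of u = proj₁ (find u)

      functional : ∀ {u i} → (u , i) ∈ˡ X → centre-of u ≡ i
      functional {u} {i} ui∈ = cong proj₂ (∑≤1⇒unique (δ u ∘ proj₁) (≤-reflexive (trans (rows (δ u)) (∑-δ u)))
        (proj₂ (find u)) ui∈ (≤-reflexive (sym (δ-refl u))) (≤-reflexive (sym (δ-refl u))))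

      members : Fin p → Subset N
      members i = Vec.tabulate (λ u → does (centre-of u ≟ᶠ i))

      ∈-members⁺ : ∀ u → u ∈ members (centre-of u)
      ∈-members⁺ u = lookup⇒[]= u _ (trans (lookup∘tabulate _ u) yes-refl)
        where
        yes-refl : does (centre-of u ≟ᶠ centre-of u) ≡ true
        yes-refl with centre-of u ≟ᶠ centre-of u
        ... | yes _ = refl
        ... | no ¬r = contradiction refl ¬r

      ∈-members⁻ : ∀ {u i} → u ∈ members i → centre-of u ≡ i
      ∈-members⁻ {u} {i} u∈ with centre-of u ≟ᶠ i | trans (sym (lookup∘tabulate (λ u → does (centre-of u ≟ᶠ i)) u)) ([]=⇒lookup u∈)
      ... | yes eq | _ = eq

      ∣members∣ : ∀ i → ∣ members i ∣ ≡ k ∸ 1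
      ∣members∣ i = begin
        ∣ members i ∣                              ≡⟨ ∣tabulate∣ id (λ u → does (centre-of u ≟ᶠ i)) ⟩
        ∑ (δ i ∘ centre-of) (allFin N)             ≡⟨ rows (δ i ∘ centre-of) ⟨
        ∑ (δ i ∘ centre-of ∘ proj₁) X              ≡⟨ ∑-cong-∈ X (λ ui∈ → cong (δ i) (functional ui∈)) ⟩
        ∑ (δ i ∘ proj₂) X                          ≡⟨ columns (δ i) ⟩
        (k ∸ 1) * ∑ (δ i) (allFin p)               ≡⟨ cong ((k ∸ 1) *_) (∑-δ i) ⟩
        (k ∸ 1) * 1                                ≡⟨ *-identityʳ (k ∸ 1) ⟩
        k ∸ 1                                      ∎
        where open ≡-Reasoning

      star : Fin p → Star k n
      star i = record
        { centre  = cen n≡ i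
        ; leaves  = leafSet n≡ (members i)
        ; centre∉ = cen∉leafSet n≡
        ; size    = trans (cong suc (trans (∣leafSet∣ n≡ (members i)) (∣members∣ i))) (m+[n∸m]≡n k≥1)
        }

      Class : Fin n → Set
      Class v = (∃[ i ] v ≡ cen n≡ i) ⊎ (∃[ u ] v ≡ leaf n≡ u)

      class-root : ∀ {v} → Class v → Fin p
      class-root (inj₁ (i , _)) = i
      class-root (inj₂ (u , _)) = centre-of u

      root : ∀ v → Fin p
      root v = class-root (classify n≡ v)

      root-cen : ∀ i → root (cen n≡ i) ≡ i
      root-cen i = unique (classify n≡ (cen n≡ i))
        where
        unique : (c : Class (cen n≡ i)) → class-root c ≡ i
        unique (inj₁ (j , eq)) = sym (cen-injective n≡ eq)
        unique (inj₂ (u , eq)) = contradiction (cen<leaf n≡ i u) (<ᶠ-irrefl eq)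

      root-leaf : ∀ u → root (leaf n≡ u) ≡ centre-of u
      root-leaf u = unique (classify n≡ (leaf n≡ u))
        where
        unique : (c : Class (leaf n≡ u)) → class-root c ≡ centre-of u
        unique (inj₁ (i , eq)) = contradiction (cen<leaf n≡ i u) (<ᶠ-irrefl (sym eq))
        unique (inj₂ (v , eq)) = cong centre-of (sym (leaf-injective n≡ eq))

      leaves⇒leaf : ∀ {v i} → v ∈ leafSet n≡ (members i) → ∃[ u ] v ≡ leaf n≡ u × centre-of u ≡ i
      leaves⇒leaf {v} v∈ with classify n≡ v
      ... | inj₁ (j , refl) = contradiction v∈ (cen∉leafSet n≡)
      ... | inj₂ (u , refl) = u , refl , ∈-members⁻ (leafSet-leaf n≡ v∈)

      vertices⇒root : ∀ {v i} → v ∈ Star.vertices (star i) → root v ≡ i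
      vertices⇒root {v} {i} v∈ with x∈p∪q⁻ ⁅ cen n≡ i ⁆ _ v∈
      ... | inj₁ v∈c = trans (cong root (x∈⁅y⁆⇒x≡y (cen n≡ i) v∈c)) (root-cen i)
      ... | inj₂ v∈L with leaves⇒leaf v∈L
      ... | u , refl , eq = trans (root-leaf u) eq

      factor : StarFactor k n
      factor = record
        { star     = star
        ; disjoint = λ {i} {j} i≢j (v , v∈) → let v∈i , v∈j = x∈p∩q⁻ (Star.vertices (star i)) (Star.vertices (star j)) v∈
                                               in i≢j (trans (sym (vertices⇒root v∈i)) (vertices⇒root v∈j))
        ; covering = covering
        }
        where
        covering : ∀ v → ∃[ i ] v ∈ Star.vertices (star i)
        covering v with classify n≡ v
        ... | inj₁ (i , refl) = i , x∈p∪q⁺ (inj₁ (x∈⁅x⁆ _))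
        ... | inj₂ (u , refl) = centre-of u , x∈p∪q⁺ (inj₂ (leaf∈leafSet n≡ (∈-members⁺ u)))

      within : ∀ e → StarFactor.HasEdge factor e → e ∈ M
      within e (i , h) with HasEdge⇒Joins (star i) e h
      ... | inj₁ (u≡ , v∈) = let u , v≡ , c≡ = leaves⇒leaf v∈ in
        subst (_∈ M)
          (lookup-injective edges-unique (edge u (centre-of u)) e
            (trans (lookup-edge u (centre-of u)) (sym (cong₂ _,_ (trans u≡ (cong (cen n≡) (sym c≡))) v≡))))
          (All.lookup owned (proj₂ (find u)))
      -- Such an edge would be listed with its leaf first, against the order in `edges`.
      ... | inj₂ (v≡ , u∈) = let u , u≡ , _ = leaves⇒leaf u∈ in
        contradiction (cen<leaf n≡ i u)
          (<ᶠ-asym (subst (λ (x , y) → x <ᶠ y) (cong₂ _,_ u≡ v≡) (proj₂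
            (∈-filter⁻ (λ (u , v) → u <ᶠ? v) {xs = cartesianProduct (allFin n) (allFin n)} (∈-lookup e)))))

    assignment⇒factor : ∃[ F ] 𝓢 k n F × F ⊆ M
    assignment⇒factor = factor-in factor within

-- The strategy in the game

module Play (S : Setup) {m : ℕ} (𝓕 : Subset m → Set) (edge : Setup.Rw S → Setup.Cl S → Fin m) (1≤a : 1 ≤ Setup.a S)
  (disjoint-edges : ∀ s →
    ∑ (λ u → ∑ (λ c → χ s (edge u c)) (Setup.C₀ S) + ∑ (λ c → χ s (edge u c)) (Setup.P S)) (Setup.Rows S) ≤ ∣ s ∣)
  (winning : ∀ s → Repair.Finished S (λ (u , c) → edge u c ∈ s) → ∃[ F ] 𝓕 F × F ⊆ s)
  where
  open Setup S
  open Strategy S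
  open State
  open Repair S
  open MakerBreaker a 𝓕
  open GameTree a 𝓕

  taken : Subset m → Rw → Cl → ℕ
  taken s u c = χ s (edge u c)

  Mine : Subset m → Rw × Cl → Set
  Mine s (u , c) = edge u c ∈ s


  respond : ∀ h b (G : List (Rw × Cl)) → length G ≤ a →
    All (λ (u , i) → taken (b ∪ breakerClaims h) u i ≡ 0) G →
    ∃[ s ] Legal (claimed h ∪ b) s × (∀ p → Gain (Mine (makerClaims h)) G p → Mine (s ∪ makerClaims h) p)
  respond h b G G≤a free =
    let s , legal , owned = claim-all h b (map (uncurry edge) G)
          (≤-trans (≤-reflexive (length-map (uncurry edge) G)) G≤a) unclaimed
    in s , legal , λ { _ (inj₁ mine) → x∈p∪q⁺ (inj₂ mine) ; _ (inj₂ p∈) → owned (∈-map⁺ (uncurry edge) p∈) }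
    where
    unclaimed : ∀ {e} → e ∈ˡ map (uncurry edge) G → e ∉ b ∪ breakerClaims h
    unclaimed e∈ with ∈-map⁻ (uncurry edge) e∈
    ... | (u , i) , p∈ , refl = χ≡0⇒∉ {s = b ∪ breakerClaims h} (All.lookup free p∈)

  finished⇒won : ∀ {h} → Finished (Mine (makerClaims h)) → MakerHasWon h
  finished⇒won {h} = winning (makerClaims h)

  module Round (h : History) (b : Subset m) (legal : Legal (claimed h) b) =
    Reply S (taken (breakerClaims h)) (taken b) (taken (b ∪ breakerClaims h))
      (λ u i → χ-∪ b (breakerClaims h) (edge u i))
      (≤-trans (disjoint-edges b) (≤-trans (≤-reflexive (proj₂ legal)) (m⊓n≤m a _)))

  taken≤1 : ∀ s u i → taken s u i ≤ 1
  taken≤1 s u i = bit≤1 _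

  conclude : ∀ {Holds : (Rw × Cl → Set) → Set} t h b → Finishing Holds (taken (b ∪ breakerClaims h)) a →
    Holds (Mine (makerClaims h)) → ∃[ s ] Legal (claimed h ∪ b) s × Win t ((b , s) ∷ h)
  conclude t h b fin holds =
    let open Finishing fin
        s , legal , owned = respond h b claims #claims≤ free
    in s , legal , won⇒Win t (finished⇒won {(b , s) ∷ h} (Finished-map (λ {p} → owned p) (finished holds)))

  -- The strict inequality reserves one spare edge. A full move lowers both sides by `a`. With at
  -- most `a` leaves left the current move is the last one, unless |U| = a and the exchange is
  -- postponed; then |U| < t * a forces t ≥ 2.
  wins : ∀ t h st → Held st (Mine (makerClaims h)) → Position.Inv (taken (breakerClaims h)) 0 st →
    length (U st) < t * a → Win t h
  wins (suc t) h st holding inv U<ta = inj₂ answer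
    where
    answer : ∀ b → Legal (claimed h) b → ∃[ s ] Legal (claimed h ∪ b) s × Win t ((b , s) ∷ h)
    answer b legal with length (U st) ≤? a
    ... | no U≰a =
      let open Position.Move (Position.steps (taken (b ∪ breakerClaims h)) a st ≤-refl (≰⇒> U≰a) (Round.reply h b legal st inv))
          s , legal′ , owned = respond h b claims (≤-reflexive #claims) free
      in s , legal′ , wins t ((b , s) ∷ h) next (Held-map next owned (held {Mine (makerClaims h)} holding)) invariant
           (+-cancelˡ-< a _ _ (subst (_< a + t * a) shrinks U<ta))
    ... | yes U≤a with Endgame.endgame S (taken (b ∪ breakerClaims h)) (taken≤1 (b ∪ breakerClaims h)) st U≤a
                         (Round.reply h b legal st inv)
    ... | inj₁ fin = conclude t h b fin holding
    ... | inj₂ (U≡a , post) = two-rounds t U<ta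
      where
      open Endgame.Postponing post
      two-rounds : ∀ t → length (U st) < suc t * a → ∃[ s ] Legal (claimed h ∪ b) s × Win t ((b , s) ∷ h)
      two-rounds zero    U<a = contradiction (≤-trans U<a (≤-reflexive (trans (+-identityʳ a) (sym U≡a)))) (<-irrefl refl)
      two-rounds (suc t) _   =
        let s , legal′ , owned = respond h b claims #claims≤ free
            h′ = (b , s) ∷ h
        in s , legal′ , inj₂ λ b′ legal″ →
          conclude t h′ b′ (Round.finish-pending h′ b′ legal″ 1≤a (taken≤1 (b′ ∪ breakerClaims h′)) pending′)
            (Endgame.Pending.Awaiting-map pending′ owned (awaits {Mine (makerClaims h)} holding))

-- Parameters and the number of moves

repeat : ∀ {A : Set} → ℕ → List A → List A
repeat zero    xs = []
repeat (suc m) xs = xs ++ repeat m xs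

∑-repeat : ∀ {A : Set} (f : A → ℕ) m xs → ∑ f (repeat m xs) ≡ m * ∑ f xs
∑-repeat f zero    xs = refl
∑-repeat f (suc m) xs = trans (∑-++ f xs (repeat m xs)) (cong (∑ f xs +_) (∑-repeat f m xs))

poolSize : ℕ → ℕ
poolSize a = 4 * a + 3

-- Room for the reserved centres and for as many others as `C₀-large` demands with κ = j + 1.
threshold : ℕ → ℕ → ℕ
threshold a j = suc (poolSize a + (suc (suc j) * a + 2 * poolSize a))

module Game (a j n : ℕ) (1≤a : 1 ≤ a) .{{_ : NonZero (3 + j)}}
  (n≡ : n / (3 + j) + (2 + j) * (n / (3 + j)) ≡ n) (p-large : threshold a j ≤ n / (3 + j)) where

  k N : ℕ
  k = 3 + j
  N = (2 + j) * (n / k)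

  open Assignment {k} {n} (s≤s z≤n) {N} n≡

  -- With the slots of its own that Setup grants it, every centre has 2 + j slots.
  Cols P C₀ A₀ : List (Fin p)
  Cols = allFin p
  P    = take (poolSize a) Cols
  C₀   = drop (poolSize a) Cols
  A₀   = C₀ ++ repeat j (C₀ ++ P)

  ∑-Cols : ∀ f → ∑ f C₀ + ∑ f P ≡ ∑ f Cols
  ∑-Cols f = trans (+-comm (∑ f C₀) (∑ f P))
    (trans (sym (∑-++ f P C₀)) (cong (∑ f) (take++drop≡id (poolSize a) Cols)))

  ∑-A₀ : ∀ f → ∑ f A₀ ≡ ∑ f C₀ + j * (∑ f C₀ + ∑ f P)
  ∑-A₀ f = trans (∑-++ f C₀ _) (cong (∑ f C₀ +_) (trans (∑-repeat f j (C₀ ++ P)) (cong (j *_) (∑-++ f C₀ P))))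

  slots-total : ∀ f → ∑ f A₀ + ∑ f C₀ + 2 * ∑ f P ≡ (2 + j) * ∑ f Cols
  slots-total f = trans (cong (λ z → z + ∑ f C₀ + 2 * ∑ f P) (∑-A₀ f))
    (trans (arith j (∑ f C₀) (∑ f P)) (cong ((2 + j) *_) (∑-Cols f)))
    where
    arith : ∀ j c q → c + j * (c + q) + c + 2 * q ≡ (2 + j) * (c + q)
    arith = solve-∀

  length-allFin : ∀ m → length (allFin m) ≡ m
  length-allFin m = length-tabulate {n = m} id

  |P| : length P ≡ poolSize a
  |P| = trans (length-take (poolSize a) Cols) (m≤n⇒m⊓n≡m (≤-trans (≤-trans (m≤m+n (poolSize a) _) (n≤1+n _))
    (≤-trans p-large (≤-reflexive (sym (length-allFin p))))))

  |C₀| : length C₀ ≡ p ∸ poolSize a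
  |C₀| = trans (length-drop (poolSize a) Cols) (cong (_∸ poolSize a) (length-allFin p))

  setup : Setup
  setup = record
    { Rw = Fin N ; Cl = Fin p ; Rows = allFin N ; C₀ = C₀ ; P = P ; A₀ = A₀ ; a = a ; κ = suc j
    ; complete = λ f o → ≤-trans (≤-trans (m≤m+n _ _) (≤-reflexive (sym (∑-split (proj₂ (∈⇒Split (∈-allFin o))) f))))
        (≤-reflexive (sym (∑-Cols f)))
    -- Here κ = j + 1: in `A₀` an ordinary centre occurs j + 1 times and a reserved one j times.
    ; A₀-bound = λ f → ≤-trans (≤-reflexive (∑-A₀ f)) (+-monoˡ-≤ _ (m≤m+n (∑ f C₀) (∑ f P)))
    ; balanced = begin
        length (allFin N)                                     ≡⟨ length-allFin N ⟩
        (2 + j) * p                                           ≡⟨ cong ((2 + j) *_) (length-allFin p) ⟨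
        (2 + j) * length Cols                                 ≡⟨ cong ((2 + j) *_) (∑-1 Cols) ⟨
        (2 + j) * ∑ (λ _ → 1) Cols                            ≡⟨ slots-total (λ _ → 1) ⟨
        ∑ (λ _ → 1) A₀ + ∑ (λ _ → 1) C₀ + 2 * ∑ (λ _ → 1) P
          ≡⟨ cong₂ (λ y z → y + 2 * z) (cong₂ _+_ (∑-1 A₀) (∑-1 C₀)) (∑-1 P) ⟩
        length A₀ + length C₀ + 2 * length P                  ∎
    ; C₀-large = ≤-trans (≤-reflexive (cong (λ z → suc (suc (suc j) * a + 2 * z)) |P|))
        (≤-trans (m+n≤o⇒m≤o∸n _
            (≤-trans (≤-reflexive (cong suc (+-comm (suc (suc j) * a + 2 * poolSize a) (poolSize a)))) p-large))
          (≤-reflexive (sym |C₀|)))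
    ; P-large = ≤-reflexive (sym |P|)
    }
    where open ≡-Reasoning


  open MakerBreaker a (𝓢 k n)
  open GameTree a (𝓢 k n)

  factor-from-pairs : ∀ s → Repair.Finished setup (λ (u , i) → edge u i ∈ s) → ∃[ F ] 𝓢 k n F × F ⊆ s
  factor-from-pairs s fin =
    assignment⇒factor s (pairs fin) (rows fin) (λ f → trans (columns fin f) (slots-total f)) (owned fin)
    where open Repair.Finished

  disjoint-edges : ∀ s →
    ∑ (λ u → ∑ (λ i → χ s (edge u i)) C₀ + ∑ (λ i → χ s (edge u i)) P) (allFin N) ≤ ∣ s ∣
  disjoint-edges s = ≤-trans (≤-reflexive (∑-cong (λ u → ∑-Cols (λ i → χ s (edge u i))) (allFin N))) (∑-χ-edges≤ s)

  module G = Play setup (𝓢 k n) edge 1≤a disjoint-edges factor-from-pairs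

  open Strategy setup using (initial; module Position)

  opening : Position.Inv (G.taken ⊥) 0 initial
  opening = Position.early (≤-reflexive D≡0) (λ f → refl) (λ f → refl)
    where
    open Position (G.taken ⊥)
    none : ∀ us cs → Bipartite.e (G.taken ⊥) us cs ≡ 0
    none us cs = trans (∑-cong (λ u → trans (∑-cong (λ c → χ-⊥ (edge u c)) cs) (∑-0 cs)) us) (∑-0 us)
    D≡0 : D initial ≡ 0
    D≡0 = cong₂ _+_ (cong₂ _+_ (none (allFin N) C₀) (none (allFin N) P)) (∑-0 C₀)

  maker-wins : ∀ t → N < t * a → Win t []
  maker-wins t N<ta = G.wins t [] initial ([] , [] , []) opening (subst (_< t * a) (sym (length-allFin N)) N<ta)

module RoundCount (a k n : ℕ) .{{_ : NonZero a}} .{{_ : NonZero k}} (k∣n : k ∣ n) where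

  private
    instance
      ka≢0 : NonZero (k * a)
      ka≢0 = m*n≢0 k a

  N q : ℕ
  N = (k ∸ 1) * (n / k)
  q = N / a

  N<[1+q]*a : N < suc q * a
  N<[1+q]*a = ≤-trans (s≤s (≤-reflexive (m≡m%n+[m/n]*n N a))) (+-monoˡ-≤ (q * a) (m%n<n N a))

  edges≡N*k : (k ∸ 1) * n ≡ N * k
  edges≡N*k = trans (cong ((k ∸ 1) *_) (sym (m/n*n≡m k∣n))) (sym (*-assoc (k ∸ 1) (n / k) k))

  edges/k≡N : ((k ∸ 1) * n) / k ≡ N
  edges/k≡N = trans (cong (_/ k) edges≡N*k) (m*n/n≡m N k)

  1+q≤quotient+1 : suc q ≤ ((k ∸ 1) * n) / (k * a) + 1
  1+q≤quotient+1 = ≤-reflexive (trans (+-comm 1 q) (cong (_+ 1) (sym (begin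
    ((k ∸ 1) * n) / (k * a)   ≡⟨ cong (_/ (k * a)) (trans edges≡N*k (*-comm N k)) ⟩
    (k * N) / (k * a)         ≡⟨ m*n/m*o≡n/o k N a ⟩
    q                         ∎))))
    where open ≡-Reasoning

  -- Here (k - 1) n = N k, and N exceeds q a because a ∤ N. The ceiling adds k a - 1 to the
  -- numerator, so exceeding q a k by one is enough to reach (q + 1) k a.
  1+q≤ceiling : a ∤ ((k ∸ 1) * n) / k → suc q ≤ ⌈ (k ∸ 1) * n / k * a ⌉
  1+q≤ceiling a∤ = ≤-trans (≤-reflexive (sym (m*n/n≡m (suc q) (k * a)))) (/-monoˡ-≤ (k * a) (begin
    suc q * (k * a)                             ≡⟨ arith k a q ⟩
    q * a * k + k * a                           ≡⟨ cong (q * a * k +_) (suc-pred (k * a)) ⟨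
    q * a * k + suc (k * a ∸ 1)                 ≡⟨ +-suc (q * a * k) (k * a ∸ 1) ⟩
    suc (q * a * k) + (k * a ∸ 1)               ≤⟨ +-monoˡ-≤ (k * a ∸ 1) remainder ⟩
    N * k + (k * a ∸ 1)                         ≡⟨ cong (_+ (k * a ∸ 1)) edges≡N*k ⟨
    (k ∸ 1) * n + (k * a ∸ 1)                   ∎))
    where
    open ≤-Reasoning
    arith : ∀ k a q → suc q * (k * a) ≡ q * a * k + k * a
    arith = solve-∀
    0<r : 0 < N % a
    0<r = n≢0⇒n>0 (λ r≡0 → a∤ (subst (a ∣_) (sym edges/k≡N) (m%n≡0⇒n∣m N a r≡0)))
    remainder : suc (q * a * k) ≤ N * k
    remainder = begin
      suc (q * a * k)               ≤⟨ +-monoˡ-≤ (q * a * k) (*-mono-≤ 0<r (>-nonZero⁻¹ k)) ⟩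
      N % a * k + q * a * k         ≡⟨ *-distribʳ-+ k (N % a) (q * a) ⟨
      (N % a + q * a) * k           ≡⟨ cong (_* k) (m≡m%n+[m/n]*n N a) ⟨
      N * k                         ∎

fast-win : ∀ a j n .{{_ : NonZero (3 + j)}} → 1 ≤ a → threshold a j * (3 + j) ≤ n → 3 + j ∣ n →
  ∀ t → (2 + j) * (n / (3 + j)) < t * a → GameTree.Win a (𝓢 (3 + j) n) t []
fast-win a j n 1≤a n-large k∣n = Game.maker-wins a j n 1≤a
  (trans (*-comm (3 + j) (n / (3 + j))) (m/n*n≡m k∣n))
  (≤-trans (≤-reflexive (sym (m*n/n≡m (threshold a j) (3 + j)))) (/-monoˡ-≤ (3 + j) n-large))

theorem1p4 : (a k : ℕ) .{{_ : NonZero a}} .{{_ : NonZero k}} → 1 ≤ a → 3 ≤ k →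
    ∃[ n₀ ] ∀ n → n₀ ≤ n → k ∣ n →
    ∃[ τ ] MakerBreaker.IsTau a (𝓢 k n) τ
    × (a ∤ ((k ∸ 1) * n) / k → τ ≤ ⌈_/_⌉ ((k ∸ 1) * n) (k * a) {{m*n≢0 k a}})
    × (a ∣ ((k ∸ 1) * n) / k → τ ≤ _/_ ((k ∸ 1) * n) (k * a) {{m*n≢0 k a}} + 1)
theorem1p4 a k@(suc (suc (suc j))) 1≤a (s≤s (s≤s (s≤s z≤n))) = threshold a j * (3 + j) , λ n n-large k∣n →
  let open RoundCount a k n k∣n
      open GameTree a (𝓢 k n)
      open Decision (λ h → factor-in? (MakerBreaker.makerClaims a (𝓢 k n) h))
      -- The same number q + 1 of moves serves both cases: with q the integer part of N / a, it is
      -- the ceiling if a ∤ N, and the quotient plus one otherwise.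
      τ , isTau , τ≤ = least-time (suc q) (Win⇒MakerWinsWithin (suc q) (fast-win a j n 1≤a n-large k∣n (suc q) N<[1+q]*a))
  in τ , isTau , (λ a∤ → ≤-trans τ≤ (1+q≤ceiling a∤)) , λ _ → ≤-trans τ≤ 1+q≤quotient+1
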